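{- Let $G$ be an $n$-vertex graph and let $H$ be an induced subgraph of $G$ obtained by sampling each vertex of $G$ independently with probability $p \in (0,1)$, such that $(2\ln n)/p$ is an integer. Then $$ \Pr\left(\chi(H) < \frac{p}{2\ln n}\cdot \chi(G) - 1\right) \leq \frac{1}{2}. $$
   Context: $\chi(\cdot)$ denotes the chromatic number, and $\ln$ is the natural logarithm. $H=G[S]$, where $S$ is the random set of sampled vertices. -}

module Defs where

open import Data.Bool.Base using (if_then_else_)
open import Data.Fin.Base using (Fin; zero; suc; finToFun; funToFin)
open import Data.Fin.Properties using (any?; all?; finToFun-funToFin)
  renaming (_≟_ to _≟ᶠ_)
open import Data.Fin.Subset using (Subset; ∣_∣; inside; outside)
open import Data.Integer.Base as ℤ using (ℤ; +_)
import Data.Integer.Properties as ℤ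
open import Data.Nat.Base as ℕ using (ℕ; zero; suc; z≤n; s≤s)
import Data.Nat.Properties as ℕ
open import Data.Product.Base using (∃-syntax; _×_; _,_; proj₁; proj₂)
import Data.Rational.Base
open import Data.Rational.Base as ℚ using (ℚ; 0ℚ; 1ℚ; ½)
import Data.Rational.Properties as ℚ
open import Data.Rational.Solver using (module +-*-Solver)
import Data.Rational.Unnormalised.Base as ℚᵘ
import Data.Rational.Unnormalised.Properties as ℚᵘ
open import Data.Sum.Base using (_⊎_; inj₁; inj₂)
open import Data.Vec.Base using ([]; _∷_)
open import Function.Base using (id; _∘_)
open import Relation.Binary.Core using (Rel)
import Relation.Binary.Definitions as B
open import Relation.Binary.PropositionalEquality
open import Relation.Nullary using (¬_; Dec; yes; no; does; contradiction)
open import Relation.Nullary.Decidable using (map′; ¬?; _→-dec_; True; toWitness)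
open import Relation.Unary using (Pred; Decidable)
open import Level using (0ℓ)

------------------------------------------------------------------------
-- Rational arithmetic

module Rational where
  open Data.Rational.Base using (_+_; _*_; _-_; -_; _<_; _≤_) renaming (∣_∣ to abs)
  open +-*-Solver

  from-yes : ∀ {P : Set} (P? : Dec P) {_ : True P?} → P
  from-yes P? {t} = toWitness t

  0<½ : 0ℚ < ½
  0<½ = from-yes (0ℚ ℚ.<? ½)

  0<1 : 0ℚ < 1ℚ
  0<1 = from-yes (0ℚ ℚ.<? 1ℚ)

  *-pos : ∀ {a b} → 0ℚ < a → 0ℚ < b → 0ℚ < a * b
  *-pos {a} {b} 0<a 0<b =
    ℚ.positive⁻¹ (a * b) {{ℚ.pos*pos⇒pos a {{ℚ.positive 0<a}} b {{ℚ.positive 0<b}}}}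

  half-pos : ∀ {a} → 0ℚ < a → 0ℚ < ½ * a
  half-pos = *-pos 0<½

  halves : ∀ a → ½ * a + ½ * a ≡ a
  halves = solve 1 (λ a → con ½ :* a :+ con ½ :* a := a) refl

  *-mono : ∀ {a b c d} → 0ℚ ≤ a → 0ℚ ≤ d → a ≤ b → c ≤ d → a * c ≤ b * d
  *-mono {a} {b} {c} {d} 0≤a 0≤d a≤b c≤d = ℚ.≤-trans
    (ℚ.*-monoˡ-≤-nonNeg a {{ℚ.nonNegative 0≤a}} c≤d)
    (ℚ.*-monoʳ-≤-nonNeg d {{ℚ.nonNegative 0≤d}} a≤b)

  ≤⇒0≤- : ∀ {a b} → a ≤ b → 0ℚ ≤ b - a
  ≤⇒0≤- {a} {b} a≤b = subst (_≤ b - a) (ℚ.+-inverseʳ a) (ℚ.+-monoˡ-≤ (- a) a≤b)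

  <⇒0<- : ∀ {a b} → a < b → 0ℚ < b - a
  <⇒0<- {a} {b} a<b = subst (_< b - a) (ℚ.+-inverseʳ a) (ℚ.+-monoˡ-< (- a) a<b)

  abs-sym : ∀ a b → abs (a - b) ≡ abs (b - a)
  abs-sym a b = trans (sym (ℚ.∣-p∣≡∣p∣ (a - b)))
    (cong abs (solve 2 (λ a b → :- (a :- b) := b :- a) refl a b))

  ≤abs : ∀ a → a ≤ abs a
  ≤abs a with ℚ.≤-total 0ℚ a
  ... | inj₁ 0≤a = ℚ.≤-reflexive (sym (ℚ.0≤p⇒∣p∣≡p 0≤a))
  ... | inj₂ a≤0 = ℚ.≤-trans a≤0 (ℚ.0≤∣p∣ a)

  abs-< : ∀ {a b} → a < b → - b < a → abs a < b
  abs-< {a} {b} a<b -b<a with ℚ.∣p∣≡p∨∣p∣≡-p a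
  ... | inj₁ eq = subst (_< b) (sym eq) a<b
  ... | inj₂ eq = subst₂ _<_ (sym eq) (solve 1 (λ b → :- (:- b) := b) refl b)
                    (ℚ.neg-antimono-< -b<a)

  near-< : ∀ a b {d} → abs (a - b) < d → a < b + d
  near-< a b {d} h = subst₂ _<_
    (solve 2 (λ a b → b :+ (a :- b) := a) refl a b) refl
    (ℚ.+-monoʳ-< b (ℚ.≤-<-trans (≤abs (a - b)) h))

  near-half : ∀ {a b c} → c ≤ a → abs (a - b) < ½ * c → ½ * c < b
  near-half {a} {b} {c} c≤a h = subst₂ _<_
    (solve 1 (λ c → c :- con ½ :* c := con ½ :* c) refl c)
    (solve 2 (λ b e → (b :+ e) :- e := b) refl b (½ * c))
    (ℚ.+-monoˡ-< (- (½ * c)) (ℚ.≤-<-trans c≤a (near-< a b h)))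

  near-midpoint : ∀ {a b c} → abs (b - a) < ½ * (a - c) → c + ½ * (a - c) < b
  near-midpoint {a} {b} {c} h = subst₂ _<_
    (solve 2 (λ a c → a :- con ½ :* (a :- c) := c :+ con ½ :* (a :- c)) refl a c)
    (solve 2 (λ b e → (b :+ e) :- e := b) refl b (½ * (a - c)))
    (ℚ.+-monoˡ-< (- (½ * (a - c))) (near-< a b (subst (_< ½ * (a - c)) (abs-sym b a) h)))

open Rational

fromℕ/1 : ℕ → ℚ
fromℕ/1 n = + n ℚ./ 1

-- Total reciprocal, with 0⁻¹ = 0.
recip : ℚ → ℚ
recip q with q ℚ.≟ 0ℚ
... | yes _   = 0ℚ
... | no q≢0 = (ℚ.1/ q) {{ℚ.≢-nonZero q≢0}}

module Reciprocal where
  open Data.Rational.Base using (_+_; _*_; _-_; -_; _<_; _≤_) renaming (∣_∣ to abs)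
  open +-*-Solver

  recip-inverse : ∀ {q} → q ≢ 0ℚ → q * recip q ≡ 1ℚ
  recip-inverse {q} q≢0 with q ℚ.≟ 0ℚ
  ... | yes q≡0 = contradiction q≡0 q≢0
  ... | no q≢0′ = ℚ.*-inverseʳ q {{ℚ.≢-nonZero q≢0′}}

  >⇒≢ : ∀ {q} → 0ℚ < q → q ≢ 0ℚ
  >⇒≢ 0<q q≡0 = ℚ.<⇒≢ 0<q (sym q≡0)

  recip-pos : ∀ {q} → 0ℚ < q → 0ℚ < recip q
  recip-pos {q} 0<q with q ℚ.≟ 0ℚ
  ... | yes q≡0 = contradiction q≡0 (>⇒≢ 0<q)
  ... | no q≢0 = ℚ.positive⁻¹ _ {{ℚ.1/pos⇒pos q {{ℚ.positive 0<q}}}}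

  cancelʳ : ∀ a {b} → 0ℚ < b → (a * recip b) * b ≡ a
  cancelʳ a {b} 0<b = begin
    (a * recip b) * b ≡⟨ solve 3 (λ a b r → (a :* r) :* b := a :* (b :* r)) refl a b (recip b) ⟩
    a * (b * recip b) ≡⟨ cong (a *_) (recip-inverse (>⇒≢ 0<b)) ⟩
    a * 1ℚ            ≡⟨ ℚ.*-identityʳ a ⟩
    a                 ∎
    where open ≡-Reasoning

  recip-diff : ∀ {a b} → 0ℚ < a → 0ℚ < b →
               recip a - recip b ≡ (b - a) * (recip a * recip b)
  recip-diff {a} {b} 0<a 0<b = sym (begin
    (b - a) * (ra * rb)
      ≡⟨ solve 4 (λ a b ra rb → (b :- a) :* (ra :* rb) := ra :* (b :* rb) :- rb :* (a :* ra))
           refl a b ra rb ⟩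
    ra * (b * rb) - rb * (a * ra)
      ≡⟨ cong₂ (λ s t → ra * s - rb * t) (recip-inverse (>⇒≢ 0<b)) (recip-inverse (>⇒≢ 0<a)) ⟩
    ra * 1ℚ - rb * 1ℚ
      ≡⟨ cong₂ _-_ (ℚ.*-identityʳ ra) (ℚ.*-identityʳ rb) ⟩
    ra - rb ∎)
    where open ≡-Reasoning ; ra = recip a ; rb = recip b

  recip-antitone : ∀ {a b} → 0ℚ < a → a ≤ b → recip b ≤ recip a
  recip-antitone {a} {b} 0<a a≤b = subst₂ _≤_ (ℚ.+-identityˡ (recip b))
    (solve 2 (λ x y → (x :- y) :+ y := x) refl (recip a) (recip b))
    (ℚ.+-monoˡ-≤ (recip b) (subst (0ℚ ≤_) (sym (recip-diff 0<a 0<b))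
      (subst (_≤ (b - a) * (recip a * recip b)) (ℚ.*-zeroˡ (recip a * recip b))
        (ℚ.*-monoʳ-≤-nonNeg (recip a * recip b)
          {{ℚ.nonNegative (ℚ.<⇒≤ (*-pos (recip-pos 0<a) (recip-pos 0<b)))}} (≤⇒0≤- a≤b)))))
    where 0<b = ℚ.<-≤-trans 0<a a≤b

  recip-close : ∀ {a b c} → 0ℚ < c → c ≤ a → c ≤ b →
                abs (recip a - recip b) ≤ abs (a - b) * (recip c * recip c)
  recip-close {a} {b} {c} 0<c c≤a c≤b = begin
    abs (recip a - recip b)                  ≡⟨ cong abs (recip-diff 0<a 0<b) ⟩
    abs ((b - a) * (recip a * recip b))      ≡⟨ ℚ.∣p*q∣≡∣p∣*∣q∣ (b - a) (recip a * recip b) ⟩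
    abs (b - a) * abs (recip a * recip b)    ≡⟨ cong₂ _*_ (abs-sym b a) (ℚ.0≤p⇒∣p∣≡p (ℚ.<⇒≤ (*-pos (recip-pos 0<a) (recip-pos 0<b)))) ⟩
    abs (a - b) * (recip a * recip b)        ≤⟨ ℚ.*-monoˡ-≤-nonNeg (abs (a - b)) {{ℚ.∣-∣-nonNeg (a - b)}}
                                                  (*-mono (ℚ.<⇒≤ (recip-pos 0<a)) (ℚ.<⇒≤ (recip-pos 0<c))
                                                    (recip-antitone 0<c c≤a) (recip-antitone 0<c c≤b)) ⟩
    abs (a - b) * (recip c * recip c)        ∎
    where
      open ℚ.≤-Reasoning
      0<a = ℚ.<-≤-trans 0<c c≤a
      0<b = ℚ.<-≤-trans 0<c c≤b

  recip-* : ∀ {a b} → 0ℚ < a → 0ℚ < b → recip (a * recip b) ≡ b * recip a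
  recip-* {a} {b} 0<a 0<b = begin
    recip q                           ≡⟨ ℚ.*-identityʳ (recip q) ⟨
    recip q * 1ℚ                      ≡⟨ cong (recip q *_) (recip-inverse (>⇒≢ 0<a)) ⟨
    recip q * (a * recip a)           ≡⟨ cong (λ t → recip q * (t * recip a)) (cancelʳ a 0<b) ⟨
    recip q * (q * b * recip a)       ≡⟨ solve 4 (λ rq q b ra → rq :* (q :* b :* ra) := (q :* rq) :* (b :* ra))
                                           refl (recip q) q b (recip a) ⟩
    (q * recip q) * (b * recip a)     ≡⟨ cong (_* (b * recip a)) (recip-inverse (>⇒≢ (*-pos 0<a (recip-pos 0<b)))) ⟩
    1ℚ * (b * recip a)                ≡⟨ ℚ.*-identityˡ (b * recip a) ⟩
    b * recip a                       ∎
    where open ≡-Reasoning ; q = a * recip b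

open Reciprocal

------------------------------------------------------------------------
-- Real numbers, as Cauchy sequences of rationals

Eventually : (ℕ → Set) → Set
Eventually P = ∃[ N ] (∀ m → N ℕ.≤ m → P m)

IsCauchy : (ℕ → ℚ) → Set
IsCauchy s = ∀ ε → 0ℚ ℚ.< ε →
  ∃[ N ] (∀ m n → N ℕ.≤ m → N ℕ.≤ n → ℚ.∣ s m ℚ.- s n ∣ ℚ.< ε)

record ℝ : Set where
  constructor mkℝ
  field
    seq    : ℕ → ℚ
    cauchy : IsCauchy seq

open ℝ public

infix 4 _≃_ _<_ _≤_

_≃_ : Rel ℝ 0ℓ
x ≃ y = ∀ ε → 0ℚ ℚ.< ε → Eventually λ m → ℚ.∣ seq x m ℚ.- seq y m ∣ ℚ.< ε

_<_ : Rel ℝ 0ℓ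
x < y = ∃[ ε ] (0ℚ ℚ.< ε × Eventually λ m → seq x m ℚ.+ ε ℚ.≤ seq y m)

_≤_ : Rel ℝ 0ℓ
x ≤ y = ¬ (y < x)

module CauchyClosure where
  open Data.Rational.Base using (_+_; _*_; _-_; -_) renaming (∣_∣ to abs)
  open +-*-Solver

  both : ∀ {P Q : ℕ → Set} → Eventually P → Eventually Q →
         Eventually λ m → P m × Q m
  both (M , p) (N , q) = M ℕ.⊔ N , λ m h →
    p m (ℕ.≤-trans (ℕ.m≤m⊔n M N) h) , q m (ℕ.≤-trans (ℕ.m≤n⊔m M N) h)

  witness : ∀ {P : ℕ → Set} → Eventually P → ∃[ m ] P m
  witness (N , p) = N , p N ℕ.≤-refl

  const-cauchy : ∀ q → IsCauchy (λ _ → q)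
  const-cauchy q ε 0<ε =
    0 , λ _ _ _ _ → subst (ℚ._< ε) (sym (cong abs (ℚ.+-inverseʳ q))) 0<ε

  +-cauchy : ∀ {s t} → IsCauchy s → IsCauchy t → IsCauchy (λ m → s m + t m)
  +-cauchy {s} {t} cs ct ε 0<ε with cs (½ * ε) (half-pos 0<ε) | ct (½ * ε) (half-pos 0<ε)
  ... | M , p | N , q = M ℕ.⊔ N , λ m n hm hn →
    ℚ.≤-<-trans
      (subst (λ z → abs z ℚ.≤ abs (s m - s n) + abs (t m - t n))
        (solve 4 (λ a b c d → (a :- c) :+ (b :- d) := (a :+ b) :- (c :+ d)) refl (s m) (t m) (s n) (t n))
        (ℚ.∣p+q∣≤∣p∣+∣q∣ (s m - s n) (t m - t n)))
      (subst (abs (s m - s n) + abs (t m - t n) ℚ.<_) (halves ε)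
        (ℚ.+-mono-< (p m n (l hm) (l hn)) (q m n (r hm) (r hn))))
    where
      l : ∀ {k} → M ℕ.⊔ N ℕ.≤ k → M ℕ.≤ k
      l = ℕ.≤-trans (ℕ.m≤m⊔n M N)
      r : ∀ {k} → M ℕ.⊔ N ℕ.≤ k → N ℕ.≤ k
      r = ℕ.≤-trans (ℕ.m≤n⊔m M N)

  neg-cauchy : ∀ {s} → IsCauchy s → IsCauchy (λ m → - s m)
  neg-cauchy {s} cs ε 0<ε with cs ε 0<ε
  ... | N , p = N , λ m n hm hn → subst (ℚ._< ε)
    (trans (abs-sym (s m) (s n))
      (cong abs (solve 2 (λ a b → b :- a := (:- a) :- (:- b)) refl (s m) (s n))))
    (p m n hm hn)

  bounded : ∀ {s} → IsCauchy s → ∃[ B ] (0ℚ ℚ.< B × Eventually λ m → abs (s m) ℚ.≤ B)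
  bounded {s} cs with cs 1ℚ 0<1
  ... | N , p = abs (s N) + 1ℚ
    , subst (ℚ._< abs (s N) + 1ℚ) (ℚ.+-identityʳ 0ℚ) (ℚ.+-mono-≤-< (ℚ.0≤∣p∣ (s N)) 0<1)
    , N , λ m h → ℚ.≤-trans
        (subst (λ z → abs z ℚ.≤ abs (s N) + abs (s m - s N))
          (solve 2 (λ a b → b :+ (a :- b) := a) refl (s m) (s N))
          (ℚ.∣p+q∣≤∣p∣+∣q∣ (s N) (s m - s N)))
        (ℚ.+-monoʳ-≤ (abs (s N)) (ℚ.<⇒≤ (p m N h ℕ.≤-refl)))

  product-term : ∀ a b {C δ} → 0ℚ ℚ.< C → abs a ℚ.≤ C → abs b ℚ.< δ → abs (b * a) ℚ.< δ * C
  product-term a b {C} {δ} 0<C a≤C b<δ = begin-strict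
    abs (b * a)     ≡⟨ ℚ.∣p*q∣≡∣p∣*∣q∣ b a ⟩
    abs b * abs a   ≤⟨ ℚ.*-monoˡ-≤-nonNeg (abs b) {{ℚ.∣-∣-nonNeg b}} a≤C ⟩
    abs b * C       <⟨ ℚ.*-monoˡ-<-pos C {{ℚ.positive 0<C}} b<δ ⟩
    δ * C           ∎
    where open ℚ.≤-Reasoning

  product-close : ∀ a b c d {C δ} → 0ℚ ℚ.< C → abs b ℚ.≤ C → abs c ℚ.≤ C →
    abs (a - c) ℚ.< δ → abs (b - d) ℚ.< δ → abs (a * b - c * d) ℚ.< δ * C + δ * C
  product-close a b c d {C} {δ} 0<C b≤C c≤C p q = begin-strict
    abs (a * b - c * d)
      ≡⟨ cong abs (solve 4 (λ a b c d → a :* b :- c :* d := (a :- c) :* b :+ (b :- d) :* c) refl a b c d) ⟩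
    abs ((a - c) * b + (b - d) * c)
      ≤⟨ ℚ.∣p+q∣≤∣p∣+∣q∣ ((a - c) * b) ((b - d) * c) ⟩
    abs ((a - c) * b) + abs ((b - d) * c)
      <⟨ ℚ.+-mono-< (product-term b (a - c) 0<C b≤C p) (product-term c (b - d) 0<C c≤C q) ⟩
    δ * C + δ * C ∎
    where open ℚ.≤-Reasoning

  *-cauchy : ∀ {s t} → IsCauchy s → IsCauchy t → IsCauchy (λ m → s m * t m)
  *-cauchy {s} {t} cs ct ε 0<ε = T , λ m n hm hn →
    subst (abs (s m * t m - s n * t n) ℚ.<_) δC≡ε
      (product-close (s m) (t m) (s n) (t n) 0<C
        (ℚ.≤-trans (boundB m (≥L hm)) B≤C) (ℚ.≤-trans (boundA n (≥K hn)) A≤C)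
        (p m n (≥M hm) (≥M hn)) (q m n (≥N hm) (≥N hn)))
    where
      A = proj₁ (bounded {s} cs)
      0<A = proj₁ (proj₂ (bounded {s} cs))
      K = proj₁ (proj₂ (proj₂ (bounded {s} cs)))
      boundA = proj₂ (proj₂ (proj₂ (bounded {s} cs)))
      B = proj₁ (bounded {t} ct)
      0<B = proj₁ (proj₂ (bounded {t} ct))
      L = proj₁ (proj₂ (proj₂ (bounded {t} ct)))
      boundB = proj₂ (proj₂ (proj₂ (bounded {t} ct)))
      C = A + B
      0<C : 0ℚ ℚ.< C
      0<C = ℚ.+-mono-< 0<A 0<B
      δ = (½ * ε) * recip C
      0<δ : 0ℚ ℚ.< δ
      0<δ = *-pos (half-pos 0<ε) (recip-pos 0<C)
      M = proj₁ (cs δ 0<δ)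
      p = proj₂ (cs δ 0<δ)
      N = proj₁ (ct δ 0<δ)
      q = proj₂ (ct δ 0<δ)
      δC≡ε : δ * C + δ * C ≡ ε
      δC≡ε = trans (cong (λ z → z + z) (cancelʳ (½ * ε) 0<C)) (halves ε)
      A≤C : A ℚ.≤ C
      A≤C = subst (ℚ._≤ C) (ℚ.+-identityʳ A) (ℚ.+-monoʳ-≤ A (ℚ.<⇒≤ 0<B))
      B≤C : B ℚ.≤ C
      B≤C = subst (ℚ._≤ C) (ℚ.+-identityˡ B) (ℚ.+-monoˡ-≤ B (ℚ.<⇒≤ 0<A))
      T = (K ℕ.⊔ L) ℕ.⊔ (M ℕ.⊔ N)
      ≥KL : ∀ {k} → T ℕ.≤ k → K ℕ.⊔ L ℕ.≤ k
      ≥KL = ℕ.≤-trans (ℕ.m≤m⊔n (K ℕ.⊔ L) (M ℕ.⊔ N))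
      ≥MN : ∀ {k} → T ℕ.≤ k → M ℕ.⊔ N ℕ.≤ k
      ≥MN = ℕ.≤-trans (ℕ.m≤n⊔m (K ℕ.⊔ L) (M ℕ.⊔ N))
      ≥K : ∀ {k} → T ℕ.≤ k → K ℕ.≤ k
      ≥K h = ℕ.≤-trans (ℕ.m≤m⊔n K L) (≥KL h)
      ≥L : ∀ {k} → T ℕ.≤ k → L ℕ.≤ k
      ≥L h = ℕ.≤-trans (ℕ.m≤n⊔m K L) (≥KL h)
      ≥M : ∀ {k} → T ℕ.≤ k → M ℕ.≤ k
      ≥M h = ℕ.≤-trans (ℕ.m≤m⊔n M N) (≥MN h)
      ≥N : ∀ {k} → T ℕ.≤ k → N ℕ.≤ k
      ≥N h = ℕ.≤-trans (ℕ.m≤n⊔m M N) (≥MN h)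

  recip-cauchy : ∀ {s c} → 0ℚ ℚ.< c → Eventually (λ m → c ℚ.≤ s m) →
                 IsCauchy s → IsCauchy (recip ∘ s)
  recip-cauchy {s} {c} 0<c (K , c≤s) cs ε 0<ε with cs (ε * (c * c)) (*-pos 0<ε (*-pos 0<c 0<c))
  ... | N , p = K ℕ.⊔ N , λ m n hm hn → begin-strict
    abs (recip (s m) - recip (s n))
      ≤⟨ recip-close 0<c (c≤s m (ℕ.≤-trans (ℕ.m≤m⊔n K N) hm)) (c≤s n (ℕ.≤-trans (ℕ.m≤m⊔n K N) hn)) ⟩
    abs (s m - s n) * (recip c * recip c)
      <⟨ ℚ.*-monoˡ-<-pos (recip c * recip c)
           {{ℚ.positive (*-pos (recip-pos 0<c) (recip-pos 0<c))}}
           (p m n (ℕ.≤-trans (ℕ.m≤n⊔m K N) hm) (ℕ.≤-trans (ℕ.m≤n⊔m K N) hn)) ⟩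
    ε * (c * c) * (recip c * recip c)
      ≡⟨ solve 3 (λ e c r → e :* (c :* c) :* (r :* r) := ((e :* r) :* c) :* r :* c) refl ε c (recip c) ⟩
    ((ε * recip c) * c) * recip c * c
      ≡⟨ cancelʳ (ε * recip c * c) 0<c ⟩
    (ε * recip c) * c
      ≡⟨ cancelʳ ε 0<c ⟩
    ε ∎
    where open ℚ.≤-Reasoning

open CauchyClosure

------------------------------------------------------------------------
-- Riemann sums for the natural logarithm

sumBelow : ℕ → (ℕ → ℚ) → ℚ
sumBelow zero    f = 0ℚ
sumBelow (suc K) f = sumBelow K f ℚ.+ f K

-- The left Riemann sum of ∫₁ⁿ dt / t with mesh 1/N, where N = suc m:
--   ∑_{i < (n - 1) N} (1 / N) · 1 / (1 + i / N)  =  ∑_{i < (n - 1) N} 1 / (N + i).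
lnSum : ℕ → ℕ → ℚ
lnSum n m = sumBelow ((n ℕ.∸ 1) ℕ.* suc m) (λ i → + 1 ℚ./ (suc m ℕ.+ i))

module Logarithm where
  open Data.Rational.Base using (_+_; _*_; _-_; -_) renaming (∣_∣ to abs)
  open +-*-Solver

  -- u j = 1 / (j + 1)
  u : ℕ → ℚ
  u j = + 1 ℚ./ suc j

  u-antitone : ∀ {i j} → i ℕ.≤ j → u j ℚ.≤ u i
  u-antitone {i} {j} i≤j = ℚ.toℚᵘ-cancel-≤
    (ℚᵘ.≤-respˡ-≃ (ℚᵘ.≃-sym (ℚ.toℚᵘ-fromℚᵘ (ℚᵘ.mkℚᵘ (+ 1) j)))
      (ℚᵘ.≤-respʳ-≃ (ℚᵘ.≃-sym (ℚ.toℚᵘ-fromℚᵘ (ℚᵘ.mkℚᵘ (+ 1) i)))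
        (ℚᵘ.*≤* (subst₂ ℤ._≤_ (sym (ℤ.*-identityˡ (+ suc i))) (sym (ℤ.*-identityˡ (+ suc j)))
          (ℤ.+≤+ (s≤s i≤j))))))

  u-pos : ∀ j → 0ℚ ℚ.< u j
  u-pos j = ℚ.positive⁻¹ (u j) {{ℚ.normalize-pos 1 (suc j)}}

  infixl 7 _⊛_
  _⊛_ : ℕ → ℕ → ℕ
  m ⊛ k = k ℕ.+ m ℕ.* suc k

  scale : ∀ m k → fromℕ/1 (suc k) * u (m ⊛ k) ≡ u m
  scale m k = ℚ.toℚᵘ-injective (begin
    ℚ.toℚᵘ (fromℕ/1 (suc k) * u (m ⊛ k))
      ≈⟨ ℚ.toℚᵘ-homo-* (fromℕ/1 (suc k)) (u (m ⊛ k)) ⟩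
    ℚ.toℚᵘ (fromℕ/1 (suc k)) ℚᵘ.* ℚ.toℚᵘ (u (m ⊛ k))
      ≈⟨ ℚᵘ.*-cong (ℚ.toℚᵘ-fromℚᵘ (ℚᵘ.mkℚᵘ (+ suc k) 0)) (ℚ.toℚᵘ-fromℚᵘ (ℚᵘ.mkℚᵘ (+ 1) (m ⊛ k))) ⟩
    ℚᵘ.mkℚᵘ (+ suc k) 0 ℚᵘ.* ℚᵘ.mkℚᵘ (+ 1) (m ⊛ k)
      ≈⟨ ℚᵘ.*≡* (cong +_ (arith m k)) ⟩
    ℚᵘ.mkℚᵘ (+ 1) m
      ≈⟨ ℚ.toℚᵘ-fromℚᵘ (ℚᵘ.mkℚᵘ (+ 1) m) ⟨
    ℚ.toℚᵘ (u m) ∎)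
    where
      open ℚᵘ.≃-Reasoning
      arith : ∀ m k → suc k ℕ.* 1 ℕ.* suc m ≡ 1 ℕ.* (1 ℕ.* (suc m ℕ.* suc k))
      arith m k = trans (cong (ℕ._* suc m) (ℕ.*-identityʳ (suc k)))
        (trans (ℕ.*-comm (suc k) (suc m))
          (sym (trans (ℕ.*-identityˡ _) (ℕ.*-identityˡ _))))

  sum-cong : ∀ K {f g} → (∀ i → f i ≡ g i) → sumBelow K f ≡ sumBelow K g
  sum-cong zero    h = refl
  sum-cong (suc K) h = cong₂ _+_ (sum-cong K h) (h K)

  sum-mono : ∀ K {f g} → (∀ i → i ℕ.< K → f i ℚ.≤ g i) → sumBelow K f ℚ.≤ sumBelow K g
  sum-mono zero    h = ℚ.≤-refl
  sum-mono (suc K) h =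
    ℚ.+-mono-≤ (sum-mono K (λ i i<K → h i (ℕ.m<n⇒m<1+n i<K))) (h K ℕ.≤-refl)

  fromℕ/1-suc : ∀ K → fromℕ/1 (suc K) ≡ 1ℚ + fromℕ/1 K
  fromℕ/1-suc K = ℚ.toℚᵘ-injective (begin
    ℚ.toℚᵘ (fromℕ/1 (suc K))
      ≈⟨ ℚ.toℚᵘ-fromℚᵘ (ℚᵘ.mkℚᵘ (+ suc K) 0) ⟩
    ℚᵘ.mkℚᵘ (+ suc K) 0
      ≈⟨ ℚᵘ.*≡* (cong (λ z → + z ℤ.* + 1) (cong suc (sym (ℕ.*-identityʳ K)))) ⟩
    ℚᵘ.mkℚᵘ (+ suc (K ℕ.* 1)) 0
      ≈⟨ ℚᵘ.*≡* (cong (ℤ._* + 1) (sym (lemma K))) ⟩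
    ℚ.toℚᵘ 1ℚ ℚᵘ.+ ℚᵘ.mkℚᵘ (+ K) 0
      ≈⟨ ℚᵘ.+-congʳ (ℚ.toℚᵘ 1ℚ) (ℚ.toℚᵘ-fromℚᵘ (ℚᵘ.mkℚᵘ (+ K) 0)) ⟨
    ℚ.toℚᵘ 1ℚ ℚᵘ.+ ℚ.toℚᵘ (fromℕ/1 K)
      ≈⟨ ℚ.toℚᵘ-homo-+ 1ℚ (fromℕ/1 K) ⟨
    ℚ.toℚᵘ (1ℚ + fromℕ/1 K) ∎)
    where
      open ℚᵘ.≃-Reasoning
      lemma : ∀ K → + 1 ℤ.* + 1 ℤ.+ + K ℤ.* + 1 ≡ + suc (K ℕ.* 1)
      lemma K = cong (λ z → + 1 ℤ.+ z) (sym (ℤ.pos-* K 1))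

  sum-const : ∀ K c → sumBelow K (λ _ → c) ≡ fromℕ/1 K * c
  sum-const zero    c = sym (ℚ.*-zeroˡ c)
  sum-const (suc K) c = begin
    sumBelow K (λ _ → c) + c  ≡⟨ cong (_+ c) (sum-const K c) ⟩
    fromℕ/1 K * c + c         ≡⟨ solve 2 (λ k c → k :* c :+ c := (con 1ℚ :+ k) :* c) refl (fromℕ/1 K) c ⟩
    (1ℚ + fromℕ/1 K) * c      ≡⟨ cong (_* c) (fromℕ/1-suc K) ⟨
    fromℕ/1 (suc K) * c       ∎
    where open ≡-Reasoning

  sum-split : ∀ a b f → sumBelow (b ℕ.+ a) f ≡ sumBelow a f + sumBelow b (λ j → f (j ℕ.+ a))
  sum-split a zero    f = sym (ℚ.+-identityʳ _)
  sum-split a (suc b) f = trans (cong (_+ f (b ℕ.+ a)) (sum-split a b f))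
    (ℚ.+-assoc (sumBelow a f) (sumBelow b (λ j → f (j ℕ.+ a))) (f (b ℕ.+ a)))

  sum-blocks : ∀ K M f →
    sumBelow (K ℕ.* M) f ≡ sumBelow K (λ i → sumBelow M (λ j → f (j ℕ.+ i ℕ.* M)))
  sum-blocks zero    M f = refl
  sum-blocks (suc K) M f = trans (sum-split (K ℕ.* M) M f)
    (cong (_+ sumBelow M (λ j → f (j ℕ.+ K ℕ.* M))) (sum-blocks K M f))

  telescope : ∀ K m →
    sumBelow K (λ i → u (m ℕ.+ i)) ≡
    sumBelow K (λ i → u (suc (m ℕ.+ i))) + (u m - u (m ℕ.+ K))
  telescope zero m = trans (sym (ℚ.+-inverseʳ (u m)))
    (trans (cong (λ k → u m - u k) (sym (ℕ.+-identityʳ m))) (sym (ℚ.+-identityˡ _)))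
  telescope (suc K) m = begin
    S + u (m ℕ.+ K)
      ≡⟨ cong (_+ u (m ℕ.+ K)) (telescope K m) ⟩
    S′ + (u m - u (m ℕ.+ K)) + u (m ℕ.+ K)
      ≡⟨ solve 4 (λ s a b c → s :+ (a :- b) :+ b := (s :+ c) :+ (a :- c)) refl
           S′ (u m) (u (m ℕ.+ K)) (u (suc (m ℕ.+ K))) ⟩
    (S′ + u (suc (m ℕ.+ K))) + (u m - u (suc (m ℕ.+ K)))
      ≡⟨ cong (λ k → (S′ + u (suc (m ℕ.+ K))) + (u m - u k)) (ℕ.+-suc m K) ⟨
    (S′ + u (suc (m ℕ.+ K))) + (u m - u (m ℕ.+ suc K)) ∎
    where
      open ≡-Reasoning
      S = sumBelow K (λ i → u (m ℕ.+ i))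
      S′ = sumBelow K (λ i → u (suc (m ℕ.+ i)))

  block-index : ∀ m k i j → m ⊛ k ℕ.+ (j ℕ.+ i ℕ.* suc k) ≡ (m ℕ.+ i) ⊛ k ℕ.+ j
  block-index m k i j = begin
    k ℕ.+ m ℕ.* suc k ℕ.+ (j ℕ.+ i ℕ.* suc k)
      ≡⟨ cong (k ℕ.+ m ℕ.* suc k ℕ.+_) (ℕ.+-comm j (i ℕ.* suc k)) ⟩
    k ℕ.+ m ℕ.* suc k ℕ.+ (i ℕ.* suc k ℕ.+ j)
      ≡⟨ ℕ.+-assoc (k ℕ.+ m ℕ.* suc k) (i ℕ.* suc k) j ⟨
    k ℕ.+ m ℕ.* suc k ℕ.+ i ℕ.* suc k ℕ.+ j
      ≡⟨ cong (ℕ._+ j) (ℕ.+-assoc k (m ℕ.* suc k) (i ℕ.* suc k)) ⟩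
    k ℕ.+ (m ℕ.* suc k ℕ.+ i ℕ.* suc k) ℕ.+ j
      ≡⟨ cong (λ z → k ℕ.+ z ℕ.+ j) (ℕ.*-distribʳ-+ (suc k) m i) ⟨
    (m ℕ.+ i) ⊛ k ℕ.+ j ∎
    where open ≡-Reasoning

  refine : ∀ n m k → lnSum n (m ⊛ k) ≡
    sumBelow ((n ℕ.∸ 1) ℕ.* suc m) (λ i → sumBelow (suc k) (λ j → u ((m ℕ.+ i) ⊛ k ℕ.+ j)))
  refine n m k = begin
    sumBelow ((n ℕ.∸ 1) ℕ.* (suc m ℕ.* suc k)) (λ i → u (m ⊛ k ℕ.+ i))
      ≡⟨ cong (λ K → sumBelow K (λ i → u (m ⊛ k ℕ.+ i))) (ℕ.*-assoc (n ℕ.∸ 1) (suc m) (suc k)) ⟨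
    sumBelow ((n ℕ.∸ 1) ℕ.* suc m ℕ.* suc k) (λ i → u (m ⊛ k ℕ.+ i))
      ≡⟨ sum-blocks ((n ℕ.∸ 1) ℕ.* suc m) (suc k) (λ i → u (m ⊛ k ℕ.+ i)) ⟩
    _ ≡⟨ sum-cong ((n ℕ.∸ 1) ℕ.* suc m) (λ i → sum-cong (suc k) (λ j → cong u (block-index m k i j))) ⟩
    _ ∎
    where open ≡-Reasoning

  refine-≤ : ∀ n m k → lnSum n (m ⊛ k) ℚ.≤ lnSum n m
  refine-≤ n m k = subst (ℚ._≤ lnSum n m) (sym (refine n m k))
    (sum-mono ((n ℕ.∸ 1) ℕ.* suc m) λ i _ →
      ℚ.≤-trans
        (sum-mono (suc k) {g = λ _ → u ((m ℕ.+ i) ⊛ k)} λ j _ → u-antitone (ℕ.m≤m+n ((m ℕ.+ i) ⊛ k) j))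
        (ℚ.≤-reflexive (trans (sum-const (suc k) (u ((m ℕ.+ i) ⊛ k))) (scale (m ℕ.+ i) k))))

  refine-≥ : ∀ n m k → lnSum n m ℚ.≤ lnSum n (m ⊛ k) + u m
  refine-≥ n m k = ℚ.≤-trans (ℚ.≤-reflexive (telescope K m))
    (ℚ.+-mono-≤
      (subst (sumBelow K (λ i → u (suc (m ℕ.+ i))) ℚ.≤_) (sym (refine n m k))
        (sum-mono K λ i _ →
          ℚ.≤-trans
            (ℚ.≤-reflexive (sym (trans (sum-const (suc k) (u (suc (m ℕ.+ i) ⊛ k))) (scale (suc (m ℕ.+ i)) k))))
            (sum-mono (suc k) {f = λ _ → u (suc (m ℕ.+ i) ⊛ k)} λ j j<1+k → u-antitone (next (m ℕ.+ i) j (ℕ.s≤s⁻¹ j<1+k)))))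
      (subst (u m - u (m ℕ.+ K) ℚ.≤_) (ℚ.+-identityʳ (u m))
        (ℚ.+-monoʳ-≤ (u m) (ℚ.neg-antimono-≤ (ℚ.<⇒≤ (u-pos (m ℕ.+ K)))))))
    where
      K = (n ℕ.∸ 1) ℕ.* suc m
      next : ∀ l j → j ℕ.≤ k → l ⊛ k ℕ.+ j ℕ.≤ suc l ⊛ k
      next l j j≤k = begin
        k ℕ.+ l ℕ.* suc k ℕ.+ j        ≡⟨ ℕ.+-assoc k (l ℕ.* suc k) j ⟩
        k ℕ.+ (l ℕ.* suc k ℕ.+ j)      ≡⟨ cong (k ℕ.+_) (ℕ.+-comm (l ℕ.* suc k) j) ⟩
        k ℕ.+ (j ℕ.+ l ℕ.* suc k)      ≤⟨ ℕ.+-monoʳ-≤ k (ℕ.+-monoˡ-≤ (l ℕ.* suc k) (ℕ.m≤n⇒m≤1+n j≤k)) ⟩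
        k ℕ.+ (suc k ℕ.+ l ℕ.* suc k)  ∎
        where open ℕ.≤-Reasoning

  archimedean : ∀ ε → 0ℚ ℚ.< ε → ∃[ N ] u N ℚ.< ε
  archimedean ε@(ℚ.mkℚ (+ suc a) d-1 _) _ = suc d-1 ,
    ℚ.toℚᵘ-cancel-< (ℚᵘ.<-respˡ-≃ (ℚᵘ.≃-sym (ℚ.toℚᵘ-fromℚᵘ (ℚᵘ.mkℚᵘ (+ 1) (suc d-1))))
      (ℚᵘ.*<* (subst (ℤ._< + suc a ℤ.* + suc (suc d-1)) (sym (ℤ.*-identityˡ (+ suc d-1)))
        (ℤ.+<+ (ℕ.m≤m+n (suc (suc d-1)) (a ℕ.* suc (suc d-1)))))))
  archimedean (ℚ.mkℚ (+ zero) _ _) (ℚ.*<* (ℤ.+<+ ()))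
  archimedean (ℚ.mkℚ (ℤ.-[1+ _ ]) _ _) (ℚ.*<* ())

  lnSum-cauchy : ∀ n → IsCauchy (lnSum n)
  lnSum-cauchy n ε 0<ε with archimedean ε 0<ε
  ... | N , uN<ε = N , λ m k N≤m N≤k → abs-<
    (upper m k N≤m)
    (subst (- ε ℚ.<_) (solve 2 (λ a b → :- (a :- b) := b :- a) refl (lnSum n k) (lnSum n m))
      (ℚ.neg-antimono-< (upper k m N≤k)))
    where
      ⊛-comm : ∀ m k → m ⊛ k ≡ k ⊛ m
      ⊛-comm m k = ℕ.suc-injective (ℕ.*-comm (suc m) (suc k))
      upper : ∀ m k → N ℕ.≤ m → lnSum n m - lnSum n k ℚ.< ε
      upper m k N≤m = begin-strict
        lnSum n m - lnSum n k
          ≤⟨ ℚ.+-mono-≤ (refine-≥ n m k)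
               (ℚ.neg-antimono-≤ (subst (λ z → lnSum n z ℚ.≤ lnSum n k) (⊛-comm k m) (refine-≤ n k m))) ⟩
        lnSum n (m ⊛ k) + u m - lnSum n (m ⊛ k)
          ≡⟨ solve 2 (λ a b → a :+ b :- a := b) refl (lnSum n (m ⊛ k)) (u m) ⟩
        u m
          ≤⟨ u-antitone N≤m ⟩
        u N
          <⟨ uN<ε ⟩
        ε ∎
        where open ℚ.≤-Reasoning

  lnSum-≥½ : ∀ n m → 2 ℕ.≤ n → ½ ℚ.≤ lnSum n m
  lnSum-≥½ (suc (suc n)) m (s≤s (s≤s z≤n)) = begin
    ½
      ≡⟨ scale 1 m ⟨
    fromℕ/1 (suc m) * u (1 ⊛ m)
      ≡⟨ sum-const (suc m) (u (1 ⊛ m)) ⟨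
    sumBelow (suc m) (λ _ → u (1 ⊛ m))
      ≤⟨ sum-mono (suc m) {g = λ i → u (m ℕ.+ i)} (λ i i<1+m → u-antitone (ℕ.+-monoʳ-≤ m
           (ℕ.≤-trans (ℕ.<⇒≤ i<1+m) (ℕ.≤-reflexive (sym (ℕ.*-identityˡ (suc m))))))) ⟩
    sumBelow (suc m) f
      ≡⟨ ℚ.+-identityʳ (sumBelow (suc m) f) ⟨
    sumBelow (suc m) f + 0ℚ
      ≤⟨ ℚ.+-monoʳ-≤ (sumBelow (suc m) f) (rest (n ℕ.* suc m)) ⟩
    sumBelow (suc m) f + sumBelow (n ℕ.* suc m) (λ j → f (j ℕ.+ suc m))
      ≡⟨ sum-split (suc m) (n ℕ.* suc m) f ⟨
    sumBelow (n ℕ.* suc m ℕ.+ suc m) f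
      ≡⟨ cong (λ K → sumBelow K f) (ℕ.+-comm (n ℕ.* suc m) (suc m)) ⟩
    sumBelow (suc m ℕ.+ n ℕ.* suc m) f ∎
    where
      open ℚ.≤-Reasoning
      f : ℕ → ℚ
      f i = u (m ℕ.+ i)
      rest : ∀ K → 0ℚ ℚ.≤ sumBelow K (λ j → f (j ℕ.+ suc m))
      rest K = subst (ℚ._≤ sumBelow K (λ j → f (j ℕ.+ suc m)))
        (trans (sum-const K 0ℚ) (ℚ.*-zeroʳ (fromℕ/1 K)))
        (sum-mono K {f = λ _ → 0ℚ} λ j _ → ℚ.<⇒≤ (u-pos (m ℕ.+ (j ℕ.+ suc m))))

open Logarithm

------------------------------------------------------------------------
-- Real arithmetic

fromℚ : ℚ → ℝ
fromℚ q = mkℝ (λ _ → q) (const-cauchy q)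

fromℤ : ℤ → ℝ
fromℤ k = fromℚ (k ℚ./ 1)

fromℕ : ℕ → ℝ
fromℕ n = fromℤ (+ n)

0ℝ 1ℝ : ℝ
0ℝ = fromℕ 0
1ℝ = fromℕ 1

infixl 7 _*_ _/_[_]
infixl 6 _+_ _-_
infix  8 -_

_+_ : ℝ → ℝ → ℝ
x + y = mkℝ (λ m → seq x m ℚ.+ seq y m) (+-cauchy {seq x} {seq y} (cauchy x) (cauchy y))

-_ : ℝ → ℝ
- x = mkℝ (λ m → ℚ.- seq x m) (neg-cauchy {seq x} (cauchy x))

_-_ : ℝ → ℝ → ℝ
x - y = x + (- y)

_*_ : ℝ → ℝ → ℝ
x * y = mkℝ (λ m → seq x m ℚ.* seq y m) (*-cauchy {seq x} {seq y} (cauchy x) (cauchy y))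

eventually-≥ : ∀ {y} (0<y : 0ℝ < y) → Eventually λ m → proj₁ 0<y ℚ.≤ seq y m
eventually-≥ {y} (ε , _ , N , p) =
  N , λ m h → subst (ℚ._≤ seq y m) (ℚ.+-identityˡ ε) (p m h)

-- Division by a positive real. Only finitely many terms of the divisor can
-- vanish, so the value of recip at 0 does not affect the result.
_/_[_] : (x y : ℝ) → 0ℝ < y → ℝ
x / y [ 0<y ] = mkℝ (λ m → seq x m ℚ.* recip (seq y m))
  (*-cauchy {seq x} {recip ∘ seq y} (cauchy x)
    (recip-cauchy {seq y} (proj₁ (proj₂ 0<y)) (eventually-≥ {y} 0<y) (cauchy y)))

IsInteger : ℝ → Set
IsInteger x = ∃[ k ] x ≃ fromℤ k

------------------------------------------------------------------------
-- The natural logarithm of a positive integer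

-- ln n = ∫₁ⁿ dt / t, for n ≥ 1; the value 0 at n = 0 is a dummy.
ln : ℕ → ℝ
ln n = mkℝ (lnSum n) (lnSum-cauchy n)

0<2ln : ∀ {n} → 2 ℕ.≤ n → 0ℝ < fromℕ 2 * ln n
0<2ln {n} 2≤n = 1ℚ , 0<1 , 0 , λ m _ →
  ℚ.*-monoˡ-≤-nonNeg (fromℕ/1 2) (lnSum-≥½ n m 2≤n)

------------------------------------------------------------------------
-- Finite simple graphs and colourings

record Graph (n : ℕ) : Set₁ where
  field
    Adj    : Rel (Fin n) 0ℓ
    adj?   : B.Decidable Adj
    symm   : B.Symmetric Adj
    irrefl : ∀ {v} → ¬ Adj v v

open Graph public

-- The elements of S, listed in increasing order.
element : ∀ {n} (S : Subset n) → Fin ∣ S ∣ → Fin n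
element (outside ∷ S) i       = suc (element S i)
element (inside  ∷ S) zero    = zero
element (inside  ∷ S) (suc i) = suc (element S i)

-- The induced subgraph on S; its vertex i stands for element S i.
_⟦_⟧ : ∀ {n} → Graph n → (S : Subset n) → Graph ∣ S ∣
G ⟦ S ⟧ = record
  { Adj    = λ i j → Adj G (element S i) (element S j)
  ; adj?   = λ i j → adj? G (element S i) (element S j)
  ; symm   = symm G
  ; irrefl = irrefl G
  }

Proper : ∀ {n k} → Graph n → (Fin n → Fin k) → Set
Proper G c = ∀ u v → Adj G u v → c u ≢ c v

Colourable : ∀ {n} → Graph n → ℕ → Set
Colourable {n} G k = ∃[ c ] Proper {k = k} G c

IsChromaticNumber : ∀ {n} → Graph n → ℕ → Set
IsChromaticNumber G k = Colourable G k × (∀ j → Colourable G j → k ℕ.≤ j)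

colourable? : ∀ {n} (G : Graph n) → Decidable (Colourable G)
colourable? {n} G k = map′
  (λ (i , proper) → finToFun i , proper)
  (λ (c , proper) → funToFin c , λ u v uv eq → proper u v uv
    (trans (sym (finToFun-funToFin c u)) (trans eq (finToFun-funToFin c v))))
  (any? λ i → all? λ u → all? λ v →
    adj? G u v →-dec ¬? (finToFun {k} {n} i u ≟ᶠ finToFun i v))

least : ∀ {P : Pred ℕ 0ℓ} → Decidable P → ∀ k → P k →
        ∃[ l ] (P l × (∀ j → P j → l ℕ.≤ j))
least P? zero p = zero , p , λ _ _ → z≤n
least {P} P? (suc k) p with P? 0
... | yes p₀ = zero , p₀ , λ _ _ → z≤n
... | no ¬p₀ with least (P? ∘ suc) k p
...   | l , pl , minimal = suc l , pl , λ where
        zero    pj → contradiction pj ¬p₀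
        (suc j) pj → s≤s (minimal j pj)

chromaticNumber : ∀ {n} (G : Graph n) → ∃[ k ] IsChromaticNumber G k
chromaticNumber {n} G = least (colourable? G) n
  (id , λ u v uv u≡v → irrefl G (subst (Adj G u) (sym u≡v) uv))

χ : ∀ {n} → Graph n → ℕ
χ G = proj₁ (chromaticNumber G)

------------------------------------------------------------------------
-- Sampling each vertex independently with probability p

sumSubsets : ∀ {n} → (Subset n → ℝ) → ℝ
sumSubsets {zero}  f = f []
sumSubsets {suc n} f = sumSubsets (f ∘ (outside ∷_)) + sumSubsets (f ∘ (inside ∷_))

-- The probability that the set of sampled vertices is exactly S.
mass : ∀ {n} → ℝ → Subset n → ℝ
mass p []            = 1ℝ
mass p (outside ∷ S) = (1ℝ - p) * mass p S
mass p (inside  ∷ S) = p * mass p S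

Pr : ∀ {n} → ℝ → (E : Pred (Subset n) 0ℓ) → Decidable E → ℝ
Pr p E E? = sumSubsets λ S → if does (E? S) then mass p S else 0ℝ

------------------------------------------------------------------------
-- The event

threshold : ∀ {n} (p : ℝ) → 2 ℕ.≤ n → Graph n → ℝ
threshold {n} p 2≤n G = p / (fromℕ 2 * ln n) [ 0<2ln 2≤n ] * fromℕ (χ G) - 1ℝ

LowChromatic : ∀ {n} (p : ℝ) → 2 ℕ.≤ n → Graph n → Pred (Subset n) 0ℓ
LowChromatic p 2≤n G S = fromℕ (χ (G ⟦ S ⟧)) < threshold p 2≤n G

-- Order on ℝ is not decidable in general. Here it is, because the integrality
-- of (2 ln n) / p = k makes the threshold the rational number χ(G) / k - 1.
module Decidability where
  open Data.Rational.Base using () renaming (∣_∣ to abs)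
  open +-*-Solver

  <?-rational : ∀ c {y q} → y ≃ fromℚ q → Dec (fromℚ c < y)
  <?-rational c {y} {q} y≃q with c ℚ.<? q
  ... | yes c<q = yes (d , 0<d , proj₁ (y≃q d 0<d) , λ m h → below m (proj₂ (y≃q d 0<d) m h))
    where
      d = ½ ℚ.* (q ℚ.- c)
      0<d : 0ℚ ℚ.< d
      0<d = half-pos (<⇒0<- c<q)
      below : ∀ m → abs (seq y m ℚ.- q) ℚ.< d → c ℚ.+ d ℚ.≤ seq y m
      below m h = ℚ.<⇒≤ (near-midpoint {q} {seq y m} {c} h)
  <?-rational c {y} {q} y≃q | no c≮q = no λ (ε , 0<ε , ev) →
    let m , far , close = witness (both ev (y≃q ε 0<ε)) in
    ℚ.<-irrefl refl (ℚ.≤-<-trans far (ℚ.<-≤-trans (near-< (seq y m) q close)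
      (ℚ.+-monoˡ-≤ ε (ℚ.≮⇒≥ c≮q))))

  quotient-rational : ∀ {x y} (0<x : 0ℝ < x) (0<y : 0ℝ < y) →
    IsInteger (x / y [ 0<y ]) → ∃[ q ] y / x [ 0<x ] ≃ fromℚ q
  quotient-rational {x} {y} 0<x 0<y (k , x/y≃k) = recip κ , close
    where
      κ = k ℚ./ 1
      a = proj₁ 0<x
      0<a = proj₁ (proj₂ 0<x)
      b = proj₁ 0<y
      0<b = proj₁ (proj₂ 0<y)
      B = proj₁ (bounded {seq y} (cauchy y))
      0<B = proj₁ (proj₂ (bounded {seq y} (cauchy y)))
      z : ℕ → ℚ
      z m = seq x m ℚ.* recip (seq y m)
      c = a ℚ.* recip B
      0<c = *-pos 0<a (recip-pos 0<B)
      positive = both (eventually-≥ {x} 0<x) (eventually-≥ {y} 0<y)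
      bounds = both positive (proj₂ (proj₂ (bounded {seq y} (cauchy y))))
      c≤z : Eventually λ m → c ℚ.≤ z m
      c≤z = proj₁ bounds , λ m h → let (a≤x , b≤y) , y≤B = proj₂ bounds m h in
        *-mono (ℚ.<⇒≤ 0<a) (ℚ.<⇒≤ (recip-pos (ℚ.<-≤-trans 0<b b≤y))) a≤x
          (recip-antitone (ℚ.<-≤-trans 0<b b≤y) (ℚ.≤-trans (≤abs (seq y m)) y≤B))
      e = ½ ℚ.* c
      0<e = half-pos 0<c
      e≤c : e ℚ.≤ c
      e≤c = subst₂ ℚ._≤_ (ℚ.+-identityʳ e) (halves c) (ℚ.+-monoʳ-≤ e (ℚ.<⇒≤ 0<e))
      e≤κ : e ℚ.≤ κ
      e≤κ = let m , c≤zm , near = witness (both c≤z (x/y≃k e 0<e)) in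
        ℚ.<⇒≤ (near-half {z m} {κ} {c} c≤zm near)
      close : y / x [ 0<x ] ≃ fromℚ (recip κ)
      close ε 0<ε = proj₁ ev , λ m h → let (c≤zm , near) , (a≤x , b≤y) = proj₂ ev m h in begin-strict
        abs (seq y m ℚ.* recip (seq x m) ℚ.- recip κ)
          ≡⟨ cong (λ t → abs (t ℚ.- recip κ))
               (recip-* (ℚ.<-≤-trans 0<a a≤x) (ℚ.<-≤-trans 0<b b≤y)) ⟨
        abs (recip (z m) ℚ.- recip κ)
          ≤⟨ recip-close 0<e (ℚ.≤-trans e≤c c≤zm) e≤κ ⟩
        abs (z m ℚ.- κ) ℚ.* (recip e ℚ.* recip e)
          <⟨ ℚ.*-monoˡ-<-pos (recip e ℚ.* recip e)
               {{ℚ.positive (*-pos (recip-pos 0<e) (recip-pos 0<e))}} near ⟩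
        ε ℚ.* (e ℚ.* e) ℚ.* (recip e ℚ.* recip e)
          ≡⟨ solve 3 (λ x e r → x :* (e :* e) :* (r :* r) := ((x :* r) :* e) :* r :* e)
               refl ε e (recip e) ⟩
        ((ε ℚ.* recip e) ℚ.* e) ℚ.* recip e ℚ.* e
          ≡⟨ cancelʳ (ε ℚ.* recip e ℚ.* e) 0<e ⟩
        (ε ℚ.* recip e) ℚ.* e
          ≡⟨ cancelʳ ε 0<e ⟩
        ε ∎
        where
          open ℚ.≤-Reasoning
          ev = both (both c≤z (x/y≃k (ε ℚ.* (e ℚ.* e)) (*-pos 0<ε (*-pos 0<e 0<e)))) positive

  affine-rational : ∀ {x q} t → x ≃ fromℚ q →
    x * fromℕ t - 1ℝ ≃ fromℚ (q ℚ.* fromℕ/1 t ℚ.- 1ℚ)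
  affine-rational {x} {q} t x≃q ε 0<ε = proj₁ ev , λ m h → begin-strict
    abs (seq x m ℚ.* τ ℚ.- 1ℚ ℚ.- (q ℚ.* τ ℚ.- 1ℚ))
      ≡⟨ cong abs (solve 3 (λ x q t → x :* t :- con 1ℚ :- (q :* t :- con 1ℚ) := (x :- q) :* t)
           refl (seq x m) q τ) ⟩
    abs ((seq x m ℚ.- q) ℚ.* τ)
      ≡⟨ ℚ.∣p*q∣≡∣p∣*∣q∣ (seq x m ℚ.- q) τ ⟩
    abs (seq x m ℚ.- q) ℚ.* abs τ
      ≤⟨ ℚ.*-monoˡ-≤-nonNeg (abs (seq x m ℚ.- q)) {{ℚ.∣-∣-nonNeg (seq x m ℚ.- q)}} τ≤T ⟩
    abs (seq x m ℚ.- q) ℚ.* T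
      <⟨ ℚ.*-monoˡ-<-pos T {{ℚ.positive 0<T}} (proj₂ ev m h) ⟩
    (ε ℚ.* recip T) ℚ.* T
      ≡⟨ cancelʳ ε 0<T ⟩
    ε ∎
    where
      open ℚ.≤-Reasoning
      τ = fromℕ/1 t
      T = abs τ ℚ.+ 1ℚ
      0<T : 0ℚ ℚ.< T
      0<T = ℚ.+-mono-≤-< (ℚ.0≤∣p∣ τ) 0<1
      τ≤T : abs τ ℚ.≤ T
      τ≤T = subst (ℚ._≤ T) (ℚ.+-identityʳ (abs τ)) (ℚ.+-monoʳ-≤ (abs τ) (ℚ.<⇒≤ 0<1))
      ev = x≃q (ε ℚ.* recip T) (*-pos 0<ε (recip-pos 0<T))

open Decidability

abstract
  lowChromatic? : ∀ {n} (p : ℝ) (2≤n : 2 ℕ.≤ n) (0<p : 0ℝ < p) →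
                  IsInteger ((fromℕ 2 * ln n) / p [ 0<p ]) →
                  (G : Graph n) → Decidable (LowChromatic p 2≤n G)
  lowChromatic? {n} p 2≤n 0<p int G S =
    let q , eq = quotient-rational {fromℕ 2 * ln n} {p} (0<2ln 2≤n) 0<p int in
    <?-rational (fromℕ/1 (χ (G ⟦ S ⟧))) {threshold p 2≤n G}
      (affine-rational {p / (fromℕ 2 * ln n) [ 0<2ln 2≤n ]} (χ G) eq)

{-# OPTIONS --safe #-}

-- Let k = 2 ln n / p, and suppose that the family L of vertex sets S with
-- χ(G[S]) < χ(G) / k - 1 has probability more than 1/2. Let b be the largest integer
-- below 1 / p. A block of b vertices meets the sample with probability at least 1/2,
-- so by the symmetry of fair coin tosses the sample contains, with probability at
-- least 1/2, at least m elements of a given set U with |U| ≥ (2 m - 1) b. Hence some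
-- S ∈ L contains that many elements of U. Removing such sets greedily from the vertex set multiplies
-- |U| - b by at most 1 - p / 2 each time, so after k steps at most
-- b + (n - 1) exp (- ln n) < b + 1 ≤ k + 1 vertices are left. Giving these distinct
-- colours uses fewer than k (χ(G) / k - 1) + k = χ(G) colours in total.
--
-- The estimates are made for the rational approximations of p′ = (2 ln n) / k, a
-- real number equal to p; they hold exactly for each Riemann sum of ln n, so no
-- limit is taken.

module Submission where

open import Algebra.Bundles using (CommutativeRing)
import Algebra.Properties.CommutativeSemiring.Exp as Exp
open import Data.Bool.Base using (Bool; true; false; if_then_else_; T)
open import Data.Bool.Properties using () renaming (_≟_ to _≟ᵇ_)
open import Data.Fin.Base using (Fin; zero; suc; toℕ; fromℕ<)
open import Data.Fin.Properties using (toℕ<n; toℕ-injective; fromℕ<-injective)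
open import Data.Fin.Subset using (Subset; inside; outside; ∣_∣; _∩_; _─_; _∈_; ⊤)
open import Data.Fin.Subset.Properties using (anySubset?; _∈?_; ∈⊤; ∣⊤∣≡n; x∈p∧x∉q⇒x∈p─q)
open import Data.Nat.Base as ℕ using (ℕ; zero; suc; z≤n; s≤s)
import Data.Nat.DivMod as ℕ
import Data.Nat.Properties as ℕ
open import Data.Nat.Tactic.RingSolver using (solve-∀)
open import Data.Product.Base using (∃-syntax; Σ-syntax; _×_; _,_; proj₁; proj₂)
import Data.Rational.Base
open import Data.Rational.Base as ℚ using (ℚ; 0ℚ; 1ℚ; ½)
import Data.Rational.Properties as ℚ
open import Data.Rational.Solver using (module +-*-Solver)
open import Data.Vec.Base using ([]; _∷_; here; there)
open import Function.Base using (_∘_; id)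
open import Level using (0ℓ)
open import Relation.Binary.PropositionalEquality
open import Relation.Nullary using (¬_; Dec; yes; no; does; contradiction)
open import Relation.Nullary.Decidable using (_×-dec_)
open import Relation.Unary using (Pred; Decidable)
import Defs

open Defs using (sumBelow; lnSum; least; Graph; Adj; irrefl; χ; chromaticNumber; Colourable; element; _⟦_⟧)
open Defs using () renaming (fromℕ/1 to ι)
open Defs.Rational
open Defs.Logarithm using (u; u-pos; scale; archimedean; lnSum-≥½) renaming (fromℕ/1-suc to ι-suc)
open Exp (CommutativeRing.commutativeSemiring ℚ.+-*-commutativeRing) using (_^_; ^-distrib-*)

-- Ordered arithmetic of the rationals and Bernoulli's inequality

module RationalArithmetic where
  open Data.Rational.Base using (_+_; _*_; _-_; -_; _<_; _≤_)
  open +-*-Solver using (solve; con; _:+_; _:*_; _:-_; _:=_)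

  -- Reduces an inequality to an explicit nonnegative slack `c` and an identity that the ring solver
  -- can check.
  +⇒≤ : ∀ {a b} c → 0ℚ ≤ c → a + c ≡ b → a ≤ b
  +⇒≤ {a} c 0≤c refl = subst (_≤ a + c) (ℚ.+-identityʳ a) (ℚ.+-monoʳ-≤ a 0≤c)

  0≤1 : 0ℚ ≤ 1ℚ
  0≤1 = ℚ.<⇒≤ 0<1

  0≤* : ∀ {a b} → 0ℚ ≤ a → 0ℚ ≤ b → 0ℚ ≤ a * b
  0≤* {a} {b} 0≤a 0≤b =
    subst (_≤ a * b) (ℚ.*-zeroʳ a) (ℚ.*-monoˡ-≤-nonNeg a {{ℚ.nonNegative 0≤a}} 0≤b)

  0≤+ : ∀ {a b} → 0ℚ ≤ a → 0ℚ ≤ b → 0ℚ ≤ a + b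
  0≤+ 0≤a 0≤b = ℚ.+-mono-≤ 0≤a 0≤b

  ι-+ : ∀ a b → ι (a ℕ.+ b) ≡ ι a + ι b
  ι-+ zero    b = sym (ℚ.+-identityˡ (ι b))
  ι-+ (suc a) b = begin
    ι (suc (a ℕ.+ b))   ≡⟨ ι-suc (a ℕ.+ b) ⟩
    1ℚ + ι (a ℕ.+ b)    ≡⟨ cong (1ℚ +_) (ι-+ a b) ⟩
    1ℚ + (ι a + ι b)    ≡⟨ ℚ.+-assoc 1ℚ (ι a) (ι b) ⟨
    1ℚ + ι a + ι b      ≡⟨ cong (_+ ι b) (ι-suc a) ⟨
    ι (suc a) + ι b     ∎
    where open ≡-Reasoning

  ι-* : ∀ a b → ι (a ℕ.* b) ≡ ι a * ι b
  ι-* zero    b = sym (ℚ.*-zeroˡ (ι b))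
  ι-* (suc a) b = begin
    ι (b ℕ.+ a ℕ.* b)   ≡⟨ ι-+ b (a ℕ.* b) ⟩
    ι b + ι (a ℕ.* b)   ≡⟨ cong (ι b +_) (ι-* a b) ⟩
    ι b + ι a * ι b     ≡⟨ solve 2 (λ a b → b :+ a :* b := (con 1ℚ :+ a) :* b) refl (ι a) (ι b) ⟩
    (1ℚ + ι a) * ι b    ≡⟨ cong (_* ι b) (ι-suc a) ⟨
    ι (suc a) * ι b     ∎
    where open ≡-Reasoning

  0≤ι : ∀ a → 0ℚ ≤ ι a
  0≤ι zero    = ℚ.≤-refl
  0≤ι (suc a) = subst (0ℚ ≤_) (sym (ι-suc a)) (0≤+ 0≤1 (0≤ι a))

  0<ι : ∀ a → 0ℚ < ι (suc a)
  0<ι a = subst (0ℚ <_) (sym (ι-suc a)) (ℚ.+-mono-<-≤ 0<1 (0≤ι a))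

  ι-mono-≤ : ∀ {a b} → a ℕ.≤ b → ι a ≤ ι b
  ι-mono-≤ {a} {b} a≤b = +⇒≤ (ι (b ℕ.∸ a)) (0≤ι (b ℕ.∸ a))
    (trans (sym (ι-+ a (b ℕ.∸ a))) (cong ι (ℕ.m+[n∸m]≡n a≤b)))

  ι-mono-< : ∀ {a b} → a ℕ.< b → ι a < ι b
  ι-mono-< {a} a<b = ℚ.<-≤-trans
    (subst₂ _<_ (ℚ.+-identityˡ (ι a)) (sym (ι-suc a)) (ℚ.+-monoˡ-< (ι a) 0<1))
    (ι-mono-≤ a<b)

  ι-cancel-≤ : ∀ {a b} → ι a ≤ ι b → a ℕ.≤ b
  ι-cancel-≤ ιa≤ιb = ℕ.≮⇒≥ λ b<a → ℚ.<-irrefl refl (ℚ.<-≤-trans (ι-mono-< b<a) ιa≤ιb)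

  ι-cancel-< : ∀ {a b} → ι a < ι b → a ℕ.< b
  ι-cancel-< ιa<ιb = ℕ.≰⇒> λ b≤a → ℚ.<-irrefl refl (ℚ.<-≤-trans ιa<ιb (ι-mono-≤ b≤a))

  0≤^ : ∀ {x} k → 0ℚ ≤ x → 0ℚ ≤ x ^ k
  0≤^ zero    0≤x = 0≤1
  0≤^ (suc k) 0≤x = 0≤* 0≤x (0≤^ k 0≤x)

  0<^ : ∀ {x} k → 0ℚ < x → 0ℚ < x ^ k
  0<^ zero    0<x = 0<1
  0<^ (suc k) 0<x = *-pos 0<x (0<^ k 0<x)

  ^-mono-≤ : ∀ {x y} k → 0ℚ ≤ x → x ≤ y → x ^ k ≤ y ^ k
  ^-mono-≤ zero    0≤x x≤y = ℚ.≤-refl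
  ^-mono-≤ (suc k) 0≤x x≤y =
    *-mono 0≤x (0≤^ k (ℚ.≤-trans 0≤x x≤y)) x≤y (^-mono-≤ k 0≤x x≤y)

  -- Division-free form of `(1 - y) ^ k ≤ 1 / (1 + k y)`. The induction rests on `(1 - y) (1 + (k +
  -- 1) y) = 1 + k y - (k + 1) y²`, and `y ≤ 1` keeps the powers nonnegative. It serves both the
  -- logarithm bound and `block-size`.
  bernoulli : ∀ {y} k → 0ℚ ≤ y → y ≤ 1ℚ → (1ℚ - y) ^ k * (1ℚ + ι k * y) ≤ 1ℚ
  bernoulli {y} zero 0≤y y≤1 = ℚ.≤-reflexive
    (solve 1 (λ y → con 1ℚ :* (con 1ℚ :+ con 0ℚ :* y) := con 1ℚ) refl y)
  bernoulli {y} (suc k) 0≤y y≤1 = ℚ.≤-trans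
    (+⇒≤ (P * (y * y + ι k * (y * y)))
      (0≤* (0≤^ k (≤⇒0≤- y≤1)) (0≤+ (0≤* 0≤y 0≤y) (0≤* (0≤ι k) (0≤* 0≤y 0≤y))))
      (trans (cong (λ c → (1ℚ - y) * P * (1ℚ + c * y) + P * (y * y + ι k * (y * y))) (ι-suc k))
        (solve 3 (λ y P k → (con 1ℚ :- y) :* P :* (con 1ℚ :+ (con 1ℚ :+ k) :* y)
                              :+ P :* (y :* y :+ k :* (y :* y))
                            := P :* (con 1ℚ :+ k :* y)) refl y P (ι k))))
    (bernoulli k 0≤y y≤1)
    where P = (1ℚ - y) ^ k

open RationalArithmetic

-- The bound n (1 - ln n / k) ^ k ≤ 1 for every Riemann sum

module LogarithmPower where
  open Data.Rational.Base using (_+_; _*_; _-_; -_; _<_; _≤_)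
  open +-*-Solver using (solve; con; _:+_; _:*_; _:-_; _:=_)

  u-inverse : ∀ j → ι (suc j) * u j ≡ 1ℚ
  u-inverse j = trans (cong (λ i → ι (suc j) * u i) (sym (ℕ.+-identityʳ j))) (scale 0 j)

  sum-u-nonneg : ∀ m J → 0ℚ ≤ sumBelow J (λ i → u (m ℕ.+ i))
  sum-u-nonneg m zero    = ℚ.≤-refl
  sum-u-nonneg m (suc J) = 0≤+ (sum-u-nonneg m J) (ℚ.<⇒≤ (u-pos (m ℕ.+ J)))

  -- The discrete form of t · exp (- ln t) ≤ 1 at t = (m + 1 + J) / (m + 1), with
  -- exp (- x) replaced by its lower bound (1 - x / k) ^ k and 1 / k = r: then
  -- multiplying t by 1 + x is compensated by (1 - r x) ^ k.
  partial-product : ∀ {k r} m J → 0ℚ ≤ r → ι k * r ≡ 1ℚ →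
    r * sumBelow J (λ i → u (m ℕ.+ i)) ≤ 1ℚ →
    ι (suc m ℕ.+ J) * (1ℚ - r * sumBelow J (λ i → u (m ℕ.+ i))) ^ k ≤ ι (suc m)
  partial-product {k} {r} m zero 0≤r kr≡1 _ = begin
    ι (suc m ℕ.+ 0) * (1ℚ - r * 0ℚ) ^ k
      ≤⟨ ℚ.*-monoˡ-≤-nonNeg (ι (suc m ℕ.+ 0)) {{ℚ.nonNegative (0≤ι (suc m ℕ.+ 0))}} one^k ⟩
    ι (suc m ℕ.+ 0) * 1ℚ
      ≡⟨ ℚ.*-identityʳ (ι (suc m ℕ.+ 0)) ⟩
    ι (suc m ℕ.+ 0)
      ≡⟨ cong ι (ℕ.+-identityʳ (suc m)) ⟩
    ι (suc m) ∎
    where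
      open ℚ.≤-Reasoning
      base : 1ℚ - r * 0ℚ ≡ 1ℚ - 0ℚ
      base = cong (λ z → 1ℚ - z) (ℚ.*-zeroʳ r)
      -- `bernoulli` at `y = 0` says that a power of one is at most one.
      one^k : (1ℚ - r * 0ℚ) ^ k ≤ 1ℚ
      one^k = subst₂ _≤_ (trans (ℚ.*-identityʳ _) (cong (_^ k) (sym base))) refl
        (subst (λ c → (1ℚ - 0ℚ) ^ k * (1ℚ + c) ≤ 1ℚ) (ℚ.*-zeroʳ (ι k)) (bernoulli k ℚ.≤-refl 0≤1))
  partial-product {k} {r} m (suc J) 0≤r kr≡1 rS′≤1 = begin
    ι (suc m ℕ.+ suc J) * (1ℚ - r * (S + x)) ^ k
      -- Splitting off the last term `x` of the sum costs only the nonnegative cross term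
      -- `r S · r x`.
      ≤⟨ ℚ.*-monoˡ-≤-nonNeg (ι (suc m ℕ.+ suc J)) {{ℚ.nonNegative (0≤ι (suc m ℕ.+ suc J))}}
           (^-mono-≤ k (≤⇒0≤- rS′≤1) (+⇒≤ (r * S * (r * x)) (0≤* (0≤* 0≤r 0≤S) (0≤* 0≤r 0≤x))
             (solve 3 (λ r S x → con 1ℚ :- r :* (S :+ x) :+ r :* S :* (r :* x)
                               := (con 1ℚ :- r :* S) :* (con 1ℚ :- r :* x)) refl r S x))) ⟩
    ι (suc m ℕ.+ suc J) * ((1ℚ - r * S) * (1ℚ - r * x)) ^ k
      ≡⟨ cong₂ _*_ next (^-distrib-* (1ℚ - r * S) (1ℚ - r * x) k) ⟩
    V * (1ℚ + x) * ((1ℚ - r * S) ^ k * (1ℚ - r * x) ^ k)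
      ≡⟨ solve 4 (λ V x P Q → V :* (con 1ℚ :+ x) :* (P :* Q) := V :* P :* (Q :* (con 1ℚ :+ x)))
           refl V x ((1ℚ - r * S) ^ k) ((1ℚ - r * x) ^ k) ⟩
    V * (1ℚ - r * S) ^ k * ((1ℚ - r * x) ^ k * (1ℚ + x))
      ≤⟨ ℚ.*-monoˡ-≤-nonNeg (V * (1ℚ - r * S) ^ k)
           {{ℚ.nonNegative (0≤* (0≤ι (suc j)) (0≤^ k (≤⇒0≤- rS≤1)))}} (subst
             (λ c → (1ℚ - r * x) ^ k * (1ℚ + c) ≤ 1ℚ) krx≡x (bernoulli k (0≤* 0≤r 0≤x) rx≤1)) ⟩
    V * (1ℚ - r * S) ^ k * 1ℚ
      ≡⟨ ℚ.*-identityʳ (V * (1ℚ - r * S) ^ k) ⟩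
    V * (1ℚ - r * S) ^ k
      ≤⟨ partial-product {k} m J 0≤r kr≡1 rS≤1 ⟩
    ι (suc m) ∎
    where
      open ℚ.≤-Reasoning
      j = m ℕ.+ J
      V = ι (suc j)
      x = u j
      S = sumBelow J (λ i → u (m ℕ.+ i))
      0≤S = sum-u-nonneg m J
      0≤x = ℚ.<⇒≤ (u-pos j)
      rS≤1 : r * S ≤ 1ℚ
      rS≤1 = ℚ.≤-trans (+⇒≤ (r * x) (0≤* 0≤r 0≤x) (sym (ℚ.*-distribˡ-+ r S x))) rS′≤1
      rx≤1 : r * x ≤ 1ℚ
      rx≤1 = ℚ.≤-trans (+⇒≤ (r * S) (0≤* 0≤r 0≤S)
        (solve 3 (λ r S x → r :* x :+ r :* S := r :* (S :+ x)) refl r S x)) rS′≤1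
      krx≡x : ι k * (r * x) ≡ x
      krx≡x = trans (sym (ℚ.*-assoc (ι k) r x)) (trans (cong (_* x) kr≡1) (ℚ.*-identityˡ x))
      next : ι (suc m ℕ.+ suc J) ≡ V * (1ℚ + x)
      next = begin-equality
        ι (suc m ℕ.+ suc J)  ≡⟨ cong ι (ℕ.+-suc (suc m) J) ⟩
        ι (suc (suc j))      ≡⟨ ι-suc (suc j) ⟩
        1ℚ + V               ≡⟨ cong (_+ V) (u-inverse j) ⟨
        V * x + V            ≡⟨ solve 2 (λ V x → V :* x :+ V := V :* (con 1ℚ :+ x)) refl V x ⟩
        V * (1ℚ + x)         ∎

  -- For `J = (n - 1) (m + 1)` the ratio `(m + 1 + J) / (m + 1)` in `partial-product` is exactly
  -- `n`, and the factor `m + 1` cancels.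
  lnSum-power : ∀ {k r n} m → 1 ℕ.≤ n → 0ℚ ≤ r → ι k * r ≡ 1ℚ → r * lnSum n m ≤ 1ℚ →
                ι n * (1ℚ - r * lnSum n m) ^ k ≤ 1ℚ
  lnSum-power {k} {r} {suc n} m (s≤s z≤n) 0≤r kr≡1 rΛ≤1 =
    ℚ.*-cancelˡ-≤-pos (ι (suc m)) {{ℚ.positive (0<ι m)}} (begin
      ι (suc m) * (ι (suc n) * W)   ≡⟨ solve 3 (λ a b c → a :* (b :* c) := b :* a :* c) refl (ι (suc m)) (ι (suc n)) W ⟩
      ι (suc n) * ι (suc m) * W     ≡⟨ cong (_* W) (ι-* (suc n) (suc m)) ⟨
      ι (suc m ℕ.+ n ℕ.* suc m) * W ≤⟨ partial-product {k} m (n ℕ.* suc m) 0≤r kr≡1 rΛ≤1 ⟩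
      ι (suc m)                     ≡⟨ ℚ.*-identityʳ (ι (suc m)) ⟨
      ι (suc m) * 1ℚ                ∎)
    where
      open ℚ.≤-Reasoning
      W = (1ℚ - r * lnSum (suc n) m) ^ k

open LogarithmPower

-- Sampling with a rational probability, and binomial tails

module Sampling where
  open Data.Rational.Base using (_+_; _*_; _-_; -_; _<_; _≤_)
  open +-*-Solver using (solve; con; _:+_; _:*_; _:-_; _:=_)

  -- Rational counterparts of `sumSubsets`, `mass` and `Pr`, which describe each term of a real
  -- probability; events are Boolean-valued.
  sumℚ : ∀ {n} → (Subset n → ℚ) → ℚ
  sumℚ {zero}  f = f []
  sumℚ {suc n} f = sumℚ (f ∘ (outside ∷_)) + sumℚ (f ∘ (inside ∷_))

  massℚ : ∀ {n} → ℚ → Subset n → ℚ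
  massℚ q []            = 1ℚ
  massℚ q (outside ∷ S) = (1ℚ - q) * massℚ q S
  massℚ q (inside  ∷ S) = q * massℚ q S

  prob : ∀ {n} → ℚ → (Subset n → Bool) → ℚ
  prob q E = sumℚ λ S → if E S then massℚ q S else 0ℚ

  sumℚ-cong : ∀ {n} {f g : Subset n → ℚ} → (∀ S → f S ≡ g S) → sumℚ f ≡ sumℚ g
  sumℚ-cong {zero}  f≗g = f≗g []
  sumℚ-cong {suc n} f≗g = cong₂ _+_ (sumℚ-cong (f≗g ∘ (outside ∷_))) (sumℚ-cong (f≗g ∘ (inside ∷_)))

  sumℚ-mono : ∀ {n} {f g : Subset n → ℚ} → (∀ S → f S ≤ g S) → sumℚ f ≤ sumℚ g
  sumℚ-mono {zero}  f≤g = f≤g []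
  sumℚ-mono {suc n} f≤g = ℚ.+-mono-≤ (sumℚ-mono (f≤g ∘ (outside ∷_))) (sumℚ-mono (f≤g ∘ (inside ∷_)))

  sumℚ-+ : ∀ {n} (f g : Subset n → ℚ) → sumℚ (λ S → f S + g S) ≡ sumℚ f + sumℚ g
  sumℚ-+ {zero}  f g = refl
  sumℚ-+ {suc n} f g = trans
    (cong₂ _+_ (sumℚ-+ (f ∘ (outside ∷_)) (g ∘ (outside ∷_))) (sumℚ-+ (f ∘ (inside ∷_)) (g ∘ (inside ∷_))))
    (solve 4 (λ a b c d → (a :+ b) :+ (c :+ d) := (a :+ c) :+ (b :+ d)) refl
      (sumℚ (f ∘ (outside ∷_))) (sumℚ (g ∘ (outside ∷_))) (sumℚ (f ∘ (inside ∷_))) (sumℚ (g ∘ (inside ∷_))))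

  sumℚ-* : ∀ {n} c (f : Subset n → ℚ) → sumℚ (λ S → c * f S) ≡ c * sumℚ f
  sumℚ-* {zero}  c f = refl
  sumℚ-* {suc n} c f = trans
    (cong₂ _+_ (sumℚ-* c (f ∘ (outside ∷_))) (sumℚ-* c (f ∘ (inside ∷_))))
    (sym (ℚ.*-distribˡ-+ c (sumℚ (f ∘ (outside ∷_))) (sumℚ (f ∘ (inside ∷_)))))

  prob-cong : ∀ {n} q {E F : Subset n → Bool} → (∀ S → E S ≡ F S) → prob q E ≡ prob q F
  prob-cong q E≗F = sumℚ-cong λ S → cong (if_then massℚ q S else 0ℚ) (E≗F S)

  prob-∷ : ∀ {n} q (E : Subset (suc n) → Bool) →
           prob q E ≡ (1ℚ - q) * prob q (E ∘ (outside ∷_)) + q * prob q (E ∘ (inside ∷_))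
  prob-∷ {n} q E = cong₂ _+_ (factor (1ℚ - q) (E ∘ (outside ∷_))) (factor q (E ∘ (inside ∷_)))
    where
      pull : ∀ c b x → (if b then c * x else 0ℚ) ≡ c * (if b then x else 0ℚ)
      pull c true  x = refl
      pull c false x = sym (ℚ.*-zeroʳ c)
      factor : ∀ c (F : Subset n → Bool) → sumℚ (λ S → if F S then c * massℚ q S else 0ℚ) ≡ c * prob q F
      factor c F = trans (sumℚ-cong λ S → pull c (F S) (massℚ q S))
        (sumℚ-* c (λ S → if F S then massℚ q S else 0ℚ))

  mix : ∀ q a → (1ℚ - q) * a + q * a ≡ a
  mix = solve 2 (λ q a → (con 1ℚ :- q) :* a :+ q :* a := a) refl

  prob-true : ∀ n q → prob {n} q (λ _ → true) ≡ 1ℚ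
  prob-true zero    q = refl
  prob-true (suc n) q = trans (prob-∷ {n} q (λ _ → true))
    (trans (cong (λ c → (1ℚ - q) * c + q * c) (prob-true n q)) (mix q 1ℚ))

  massℚ-nonneg : ∀ {n q} → 0ℚ ≤ q → q ≤ 1ℚ → (S : Subset n) → 0ℚ ≤ massℚ q S
  massℚ-nonneg 0≤q q≤1 []            = 0≤1
  massℚ-nonneg 0≤q q≤1 (outside ∷ S) = 0≤* (≤⇒0≤- q≤1) (massℚ-nonneg 0≤q q≤1 S)
  massℚ-nonneg 0≤q q≤1 (inside  ∷ S) = 0≤* 0≤q (massℚ-nonneg 0≤q q≤1 S)

  prob-disjoint : ∀ {n q} → 0ℚ ≤ q → q ≤ 1ℚ → (E F : Subset n → Bool) →
                  (∀ S → ¬ (E S ≡ true × F S ≡ true)) → prob q E + prob q F ≤ 1ℚ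
  prob-disjoint {n} {q} 0≤q q≤1 E F disjoint = subst₂ _≤_
    (sumℚ-+ (λ S → if E S then massℚ q S else 0ℚ) (λ S → if F S then massℚ q S else 0ℚ))
    (prob-true n q) (sumℚ-mono pointwise)
    where
      pointwise : ∀ S → (if E S then massℚ q S else 0ℚ) + (if F S then massℚ q S else 0ℚ) ≤ massℚ q S
      pointwise S with E S in eq₁ | F S in eq₂
      ... | true  | true  = contradiction (eq₁ , eq₂) (disjoint S)
      ... | true  | false = ℚ.≤-reflexive (ℚ.+-identityʳ (massℚ q S))
      ... | false | true  = ℚ.≤-reflexive (ℚ.+-identityˡ (massℚ q S))
      ... | false | false = massℚ-nonneg 0≤q q≤1 S

  -- tail q u m is the probability that a binomial variable with parameters u
  -- and q is at least m.
  tail : ℚ → ℕ → ℕ → ℚ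
  tail q u       zero    = 1ℚ
  tail q zero    (suc m) = 0ℚ
  tail q (suc u) (suc m) = (1ℚ - q) * tail q u (suc m) + q * tail q u m

  -- A vertex outside `U` averages out by `mix`; a vertex of `U` is one more trial.
  prob-∩ : ∀ {n} q (U : Subset n) m → prob q (λ S → m ℕ.≤ᵇ ∣ S ∩ U ∣) ≡ tail q ∣ U ∣ m
  prob-∩ q []            zero    = refl
  prob-∩ q []            (suc m) = refl
  prob-∩ q (outside ∷ U) m       = trans (prob-∷ q (λ S → m ℕ.≤ᵇ ∣ S ∩ (outside ∷ U) ∣))
    (trans (mix q (prob q (λ S → m ℕ.≤ᵇ ∣ S ∩ U ∣))) (prob-∩ q U m))
  prob-∩ {suc n} q (inside ∷ U) zero = prob-true (suc n) q
  prob-∩ q (inside ∷ U) (suc m) = trans (prob-∷ q (λ S → suc m ℕ.≤ᵇ ∣ S ∩ (inside ∷ U) ∣))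
    (cong₂ (λ a b → (1ℚ - q) * a + q * b) (prob-∩ q U (suc m))
      (trans (prob-cong q λ S → shift m ∣ S ∩ U ∣) (prob-∩ q U m)))
    where
      shift : ∀ m k → (suc m ℕ.≤ᵇ suc k) ≡ (m ℕ.≤ᵇ k)
      shift zero    k = refl
      shift (suc m) k = refl

  module _ {q : ℚ} (0≤q : 0ℚ ≤ q) (q≤1 : q ≤ 1ℚ) where

    mix-mono : ∀ {a b c d} → a ≤ b → c ≤ d → (1ℚ - q) * a + q * c ≤ (1ℚ - q) * b + q * d
    mix-mono a≤b c≤d = ℚ.+-mono-≤
      (ℚ.*-monoˡ-≤-nonNeg (1ℚ - q) {{ℚ.nonNegative (≤⇒0≤- q≤1)}} a≤b)
      (ℚ.*-monoˡ-≤-nonNeg q {{ℚ.nonNegative 0≤q}} c≤d)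

    tail-nonneg : ∀ u m → 0ℚ ≤ tail q u m
    tail-nonneg u       zero    = 0≤1
    tail-nonneg zero    (suc m) = ℚ.≤-refl
    tail-nonneg (suc u) (suc m) =
      0≤+ (0≤* (≤⇒0≤- q≤1) (tail-nonneg u (suc m))) (0≤* 0≤q (tail-nonneg u m))

    tail-antitone : ∀ u m → tail q u (suc m) ≤ tail q u m
    tail-antitone zero    m       = tail-nonneg zero m
    tail-antitone (suc u) zero    = ℚ.≤-trans
      (mix-mono (tail-antitone u zero) ℚ.≤-refl) (ℚ.≤-reflexive (mix q 1ℚ))
    tail-antitone (suc u) (suc m) = mix-mono (tail-antitone u (suc m)) (tail-antitone u m)

    tail-mono-suc : ∀ u m → tail q u m ≤ tail q (suc u) m
    tail-mono-suc u zero    = ℚ.≤-refl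
    tail-mono-suc u (suc m) = ℚ.≤-trans (ℚ.≤-reflexive (sym (mix q (tail q u (suc m)))))
      (mix-mono ℚ.≤-refl (tail-antitone u m))

    tail-mono-+ : ∀ d u m → tail q u m ≤ tail q (d ℕ.+ u) m
    tail-mono-+ zero    u m = ℚ.≤-refl
    tail-mono-+ (suc d) u m = ℚ.≤-trans (tail-mono-+ d u m) (tail-mono-suc (d ℕ.+ u) m)

    tail-mono : ∀ {u v} m → u ℕ.≤ v → tail q u m ≤ tail q v m
    tail-mono {u} {v} m u≤v = subst (λ w → tail q u m ≤ tail q w m) (ℕ.m∸n+n≡m u≤v)
      (tail-mono-+ (v ℕ.∸ u) u m)

    -- At least one of the first b trials succeeds with probability 1 - (1 - q) ^ b.
    tail-block : ∀ b u m →
      tail q u m - (1ℚ - q) ^ b * (tail q u m - tail q u (suc m)) ≤ tail q (b ℕ.+ u) (suc m)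
    tail-block zero    u m = ℚ.≤-reflexive
      (solve 2 (λ a c → a :- con 1ℚ :* (a :- c) := c) refl (tail q u m) (tail q u (suc m)))
    tail-block (suc b) u m = ℚ.≤-trans
      (ℚ.≤-reflexive (solve 4 (λ q r a d → a :- (con 1ℚ :- q) :* r :* d
                                        := (con 1ℚ :- q) :* (a :- r :* d) :+ q :* a) refl
        q ((1ℚ - q) ^ b) (tail q u m) (tail q u m - tail q u (suc m))))
      (mix-mono (tail-block b u m) (tail-mono-+ b u m))

    module _ {b : ℕ} (block : (1ℚ - q) ^ b ≤ ½) where

      -- A block fails with probability `r ≤ ½`, so it does at least as well as a fair coin:
      -- `A - r (A - C)` is at least the average of `A` and `C` because `C ≤ A`.
      tail-half : ∀ u m → ½ * (tail q u m + tail q u (suc m)) ≤ tail q (b ℕ.+ u) (suc m)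
      tail-half u m = ℚ.≤-trans
        (+⇒≤ ((½ - r) * (A - C)) (0≤* (≤⇒0≤- block) (≤⇒0≤- (tail-antitone u m)))
          (solve 3 (λ r A C → con ½ :* (A :+ C) :+ (con ½ :- r) :* (A :- C) := A :- r :* (A :- C))
            refl r A C))
        (tail-block b u m)
        where
          r = (1ℚ - q) ^ b
          A = tail q u m
          C = tail q u (suc m)

      -- Among v blocks of b trials, the number of blocks with a success
      -- dominates the number of heads in v fair coin tosses, which is symmetric.
      tail-symmetric : ∀ v m m′ → m ℕ.+ m′ ≡ suc v →
                       1ℚ ≤ tail q (v ℕ.* b) m + tail q (v ℕ.* b) m′
      tail-symmetric v zero m′ _ = +⇒≤ (tail q (v ℕ.* b) m′) (tail-nonneg (v ℕ.* b) m′) refl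
      tail-symmetric v (suc a) zero _ =
        +⇒≤ (tail q (v ℕ.* b) (suc a)) (tail-nonneg (v ℕ.* b) (suc a)) (ℚ.+-comm 1ℚ (tail q (v ℕ.* b) (suc a)))
      tail-symmetric zero (suc a) (suc a′) eq =
        contradiction (ℕ.suc-injective eq) λ a+1+a′≡0 → ℕ.1+n≢0 (trans (sym (ℕ.+-suc a a′)) a+1+a′≡0)
      tail-symmetric (suc v) (suc a) (suc a′) eq = begin
        1ℚ
          ≡⟨ halves 1ℚ ⟨
        ½ * 1ℚ + ½ * 1ℚ
          -- The two induction hypotheses pair `a` with `a′ + 1` and `a + 1` with `a′`; regrouping
          -- the four tails gives the averages that `tail-half` bounds.
          ≤⟨ ℚ.+-mono-≤
               (ℚ.*-monoˡ-≤-nonNeg ½ (tail-symmetric v a (suc a′) a+1+a′≡1+v))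
               (ℚ.*-monoˡ-≤-nonNeg ½ (tail-symmetric v (suc a) a′ (trans (sym (ℕ.+-suc a a′)) a+1+a′≡1+v))) ⟩
        ½ * (t a + t (suc a′)) + ½ * (t (suc a) + t a′)
          ≡⟨ solve 4 (λ a b c d → con ½ :* (a :+ d) :+ con ½ :* (b :+ c)
                               := con ½ :* (a :+ b) :+ con ½ :* (c :+ d)) refl
               (t a) (t (suc a)) (t a′) (t (suc a′)) ⟩
        ½ * (t a + t (suc a)) + ½ * (t a′ + t (suc a′))
          ≤⟨ ℚ.+-mono-≤ (tail-half (v ℕ.* b) a) (tail-half (v ℕ.* b) a′) ⟩
        tail q (b ℕ.+ v ℕ.* b) (suc a) + tail q (b ℕ.+ v ℕ.* b) (suc a′) ∎
        where
          open ℚ.≤-Reasoning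
          t = tail q (v ℕ.* b)
          a+1+a′≡1+v = ℕ.suc-injective eq

      -- The hypothesis is `u ≥ (2 m - 1) b` without subtraction. For `2 m - 1` blocks,
      -- `tail-symmetric` with both thresholds equal to `m` bounds twice the tail below by one.
      tail-median : ∀ {u} m → 2 ℕ.* m ℕ.* b ℕ.≤ u ℕ.+ b → ½ ≤ tail q u m
      tail-median zero    _ = ℚ.<⇒≤ (from-yes (½ ℚ.<? 1ℚ))
      tail-median {u} (suc a) h = ℚ.≤-trans
        (subst₂ _≤_ refl (trans (ℚ.*-distribˡ-+ ½ s s) (halves s))
          (ℚ.*-monoˡ-≤-nonNeg ½ (tail-symmetric (suc (2 ℕ.* a)) (suc a) (suc a) (count a))))
        (tail-mono (suc a) (ℕ.+-cancelʳ-≤ b (suc (2 ℕ.* a) ℕ.* b) u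
          (ℕ.≤-trans (ℕ.≤-reflexive (blocks a b)) h)))
        where
          s = tail q (suc (2 ℕ.* a) ℕ.* b) (suc a)
          count : ∀ a → suc a ℕ.+ suc a ≡ suc (suc (2 ℕ.* a))
          count = solve-∀
          blocks : ∀ a b → suc (2 ℕ.* a) ℕ.* b ℕ.+ b ≡ 2 ℕ.* suc a ℕ.* b
          blocks = solve-∀

      -- Events of probability more than ½ and at least ½ cannot be disjoint; a common set is found
      -- by searching the finitely many subsets.
      meets : ∀ {n} (L : Subset n → Bool) → ½ < prob q L →
              ∀ U m → 2 ℕ.* m ℕ.* b ℕ.≤ ∣ U ∣ ℕ.+ b →
              ∃[ S ] (L S ≡ true × (m ℕ.≤ᵇ ∣ S ∩ U ∣) ≡ true)
      meets L ½<L U m h with anySubset? (λ S → (L S ≟ᵇ true) ×-dec ((m ℕ.≤ᵇ ∣ S ∩ U ∣) ≟ᵇ true))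
      ... | yes found = found
      ... | no ¬found = contradiction
        (ℚ.<-≤-trans (ℚ.+-mono-<-≤ ½<L (subst (½ ≤_) (sym (prob-∩ q U m)) (tail-median m h)))
          (prob-disjoint 0≤q q≤1 L (λ S → m ℕ.≤ᵇ ∣ S ∩ U ∣) λ S both → ¬found (S , both)))
        (ℚ.<-irrefl (halves 1ℚ))

  -- suc b is the largest integer below 1 / q.
  block-size : ∀ {q} → 0ℚ < q → q < 1ℚ →
               ∃[ b ] (q * ι (suc b) ≤ 1ℚ × (1ℚ - q) ^ suc b ≤ ½)
  block-size {q} 0<q q<1
    with N , uN<q ← archimedean q 0<q
    -- The search succeeds by `N` at the latest, since `u N = 1 / (N + 1) < q`.
    with least (λ l → 1ℚ ℚ.≤? q * ι (suc l)) N
           (ℚ.≤-trans (ℚ.≤-reflexive (trans (sym (u-inverse N)) (ℚ.*-comm (ι (suc N)) (u N))))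
             (ℚ.*-monoʳ-≤-nonNeg (ι (suc N)) {{ℚ.nonNegative (0≤ι (suc N))}} (ℚ.<⇒≤ uN<q)))
  ... | zero  , 1≤q , _ = contradiction
    (ℚ.<-≤-trans q<1 (subst (1ℚ ≤_) (ℚ.*-identityʳ q) 1≤q)) (ℚ.<-irrefl refl)
  ... | suc b , 1≤q[2+b] , minimal = b
    , ℚ.<⇒≤ (ℚ.≰⇒> λ 1≤q[1+b] → ℕ.1+n≰n (minimal b 1≤q[1+b]))
    , (begin
        (1ℚ - q) * P
          -- From `q (b + 2) ≥ 1` follows `1 - q ≤ ½ (1 + b q)`; Bernoulli's inequality then absorbs
          -- `1 + b q` into `P`.
          ≤⟨ +⇒≤ (½ * P * (q * (1ℚ + (1ℚ + ι b)) - 1ℚ))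
               (0≤* (0≤* (ℚ.<⇒≤ 0<½) (0≤^ b 0≤1-q))
                 (≤⇒0≤- (subst (λ c → 1ℚ ≤ q * c) (trans (ι-suc (suc b)) (cong (1ℚ +_) (ι-suc b))) 1≤q[2+b])))
               (solve 3 (λ q P b → (con 1ℚ :- q) :* P
                   :+ con ½ :* P :* (q :* (con 1ℚ :+ (con 1ℚ :+ b)) :- con 1ℚ)
                   := con ½ :* (P :* (con 1ℚ :+ b :* q))) refl q P (ι b)) ⟩
        ½ * (P * (1ℚ + ι b * q))
          ≤⟨ ℚ.*-monoˡ-≤-nonNeg ½ (bernoulli b (ℚ.<⇒≤ 0<q) (ℚ.<⇒≤ q<1)) ⟩
        ½ ∎)
    where
      open ℚ.≤-Reasoning
      P = (1ℚ - q) ^ b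
      0≤1-q = ≤⇒0≤- (ℚ.<⇒≤ q<1)

open Sampling

-- Colourings restricted to vertex subsets

module Colouring where

  -- Colours are natural numbers assigned to all vertices but constrained only on `U`, so colourings
  -- of different subsets combine without reindexing.
  ColourableOn : ∀ {n} → Graph n → Subset n → ℕ → Set
  ColourableOn {n} G U c = Σ[ f ∈ (Fin n → ℕ) ] ((∀ v → v ∈ U → f v ℕ.< c) ×
    (∀ u v → u ∈ U → v ∈ U → Adj G u v → f u ≢ f v))

  element-surjective : ∀ {n} (S : Subset n) v → v ∈ S → ∃[ i ] element S i ≡ v
  element-surjective (inside  ∷ S) zero    here = zero , refl
  element-surjective (inside  ∷ S) (suc v) (there v∈S) =
    let i , eq = element-surjective S v v∈S in suc i , cong suc eq
  element-surjective (outside ∷ S) (suc v) (there v∈S) =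
    let i , eq = element-surjective S v v∈S in i , cong suc eq

  induced⇒on : ∀ {n c} (G : Graph n) S → Colourable (G ⟦ S ⟧) c → ColourableOn G S c
  induced⇒on {n} {c} G S (col , proper) = (λ v → f v (v ∈? S))
    , (λ v v∈S → bound v (v ∈? S) v∈S)
    , (λ u v u∈S v∈S → separates u v (u ∈? S) (v ∈? S) u∈S v∈S)
    where
      f : ∀ v → Dec (v ∈ S) → ℕ
      f v (yes v∈S) = toℕ (col (proj₁ (element-surjective S v v∈S)))
      -- A placeholder: no condition concerns the colour of a vertex outside `S`.
      f v (no _)    = 0
      bound : ∀ v d → v ∈ S → f v d ℕ.< c
      bound v (yes v∈S) _  = toℕ<n (col (proj₁ (element-surjective S v v∈S)))
      bound v (no v∉S) v∈S = contradiction v∈S v∉S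
      separates : ∀ u v d e → u ∈ S → v ∈ S → Adj G u v → f u d ≢ f v e
      separates u v (no u∉S) _ u∈S _ = contradiction u∈S u∉S
      separates u v (yes _) (no v∉S) _ v∈S = contradiction v∈S v∉S
      separates u v (yes u∈S) (yes v∈S) _ _ uv eq = proper
        (proj₁ (element-surjective S u u∈S)) (proj₁ (element-surjective S v v∈S))
        (subst₂ (Adj G) (sym (proj₂ (element-surjective S u u∈S)))
          (sym (proj₂ (element-surjective S v v∈S))) uv)
        (toℕ-injective eq)

  -- Colours outside `S` are shifted by `a`, so the two palettes are disjoint and edges between the
  -- two parts are harmless.
  split : ∀ {n a c} (G : Graph n) U S → ColourableOn G S a → ColourableOn G (U ─ S) c →
          ColourableOn G U (a ℕ.+ c)
  split {n} {a} {c} G U S (f , f<a , f-proper) (g , g<c , g-proper) = (λ v → h v (v ∈? S))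
    , (λ v → bound v (v ∈? S))
    , (λ u v → separates u v (u ∈? S) (v ∈? S))
    where
      h : ∀ v → Dec (v ∈ S) → ℕ
      h v (yes _) = f v
      h v (no _)  = a ℕ.+ g v
      bound : ∀ v d → v ∈ U → h v d ℕ.< a ℕ.+ c
      bound v (yes v∈S) _  = ℕ.<-≤-trans (f<a v v∈S) (ℕ.m≤m+n a c)
      bound v (no v∉S) v∈U = ℕ.+-monoʳ-< a (g<c v (x∈p∧x∉q⇒x∈p─q v∈U v∉S))
      separates : ∀ u v d e → u ∈ U → v ∈ U → Adj G u v → h u d ≢ h v e
      separates u v (yes u∈S) (yes v∈S) _ _ uv = f-proper u v u∈S v∈S uv
      separates u v (yes u∈S) (no _) _ _ _ eq =
        ℕ.<⇒≱ (f<a u u∈S) (subst (a ℕ.≤_) (sym eq) (ℕ.m≤m+n a (g v)))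
      separates u v (no _) (yes v∈S) _ _ _ eq =
        ℕ.<⇒≱ (f<a v v∈S) (subst (a ℕ.≤_) eq (ℕ.m≤m+n a (g u)))
      separates u v (no u∉S) (no v∉S) u∈U v∈U uv eq = g-proper u v
        (x∈p∧x∉q⇒x∈p─q u∈U u∉S) (x∈p∧x∉q⇒x∈p─q v∈U v∉S) uv (ℕ.+-cancelˡ-≡ a (g u) (g v) eq)

  on-size : ∀ {n} (G : Graph n) U → ColourableOn G U ∣ U ∣
  on-size G U = induced⇒on G U
    (id , λ i j ij i≡j → irrefl (G ⟦ U ⟧) {j} (subst (λ i → Adj (G ⟦ U ⟧) i j) i≡j ij))

  χ-least : ∀ {n c} (G : Graph n) → ColourableOn G ⊤ c → χ G ℕ.≤ c
  χ-least G (f , f<c , proper) = proj₂ (proj₂ (chromaticNumber G)) _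
    ( (λ v → fromℕ< (f<c v ∈⊤))
    , (λ u v uv eq → proper u v ∈⊤ ∈⊤ uv (fromℕ<-injective (f u) (f v) (f<c u ∈⊤) (f<c v ∈⊤) eq)))

  ∣─∣+∣∩∣ : ∀ {n} (U S : Subset n) → ∣ U ─ S ∣ ℕ.+ ∣ S ∩ U ∣ ≡ ∣ U ∣
  ∣─∣+∣∩∣ []            []            = refl
  ∣─∣+∣∩∣ (inside  ∷ U) (inside  ∷ S) =
    trans (ℕ.+-suc ∣ U ─ S ∣ ∣ S ∩ U ∣) (cong suc (∣─∣+∣∩∣ U S))
  ∣─∣+∣∩∣ (inside  ∷ U) (outside ∷ S) = cong suc (∣─∣+∣∩∣ U S)
  ∣─∣+∣∩∣ (outside ∷ U) (inside  ∷ S) = ∣─∣+∣∩∣ U S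
  ∣─∣+∣∩∣ (outside ∷ U) (outside ∷ S) = ∣─∣+∣∩∣ U S

open Colouring

-- Greedy covering by sets of low chromatic number

module Covering where
  open Data.Rational.Base using (_+_; _*_; _-_; -_; _<_; _≤_)
  open +-*-Solver using (solve; con; _:+_; _:*_; _:-_; _:=_)

  -- One greedy step. The choice of `m` and `q B ≤ 1` give `m ≥ ½ q (u - B)`, so removing `m`
  -- vertices shrinks the excess over `B` by the factor `1 - ½ q`. The slack is a sum of four
  -- nonnegative terms, one for each hypothesis used.
  contract : ∀ {q X W} B u u′ m → 0ℚ ≤ q → 0ℚ ≤ 1ℚ - ½ * q → q * ι B ≤ 1ℚ →
    u′ ℕ.+ m ℕ.≤ u → u ℕ.≤ 2 ℕ.* m ℕ.* B ℕ.+ B →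
    ι u ≤ ι B + X * W → ι u′ ≤ ι B + X * ((1ℚ - ½ * q) * W)
  contract {q} {X} {W} B u u′ m 0≤q 0≤w qB≤1 u′+m≤u u≤2mB+B u≤B+XW = +⇒≤
    ((ι B + X * W - ι u) * (1ℚ - ½ * q) + (ι u - (ι u′ + ι m))
      + ½ * q * (ι 2 * ι m * ι B + ι B - ι u) + (1ℚ - q * ι B) * ι m)
    (0≤+ (0≤+ (0≤+
      (0≤* (≤⇒0≤- u≤B+XW) 0≤w)
      (≤⇒0≤- (subst (_≤ ι u) (ι-+ u′ m) (ι-mono-≤ u′+m≤u))))
      (0≤* (0≤* (ℚ.<⇒≤ 0<½) 0≤q) (≤⇒0≤- (subst (ι u ≤_)
        (trans (ι-+ (2 ℕ.* m ℕ.* B) B) (cong (_+ ι B)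
          (trans (ι-* (2 ℕ.* m) B) (cong (_* ι B) (ι-* 2 m)))))
        (ι-mono-≤ u≤2mB+B)))))
      (0≤* (≤⇒0≤- qB≤1) (0≤ι m)))
    (solve 7 (λ B XX W u u′ m q →
        u′ :+ ((B :+ XX :* W :- u) :* (con 1ℚ :- con ½ :* q) :+ (u :- (u′ :+ m))
          :+ con ½ :* q :* (con (ι 2) :* m :* B :+ B :- u) :+ (con 1ℚ :- q :* B) :* m)
        := B :+ XX :* ((con 1ℚ :- con ½ :* q) :* W))
      refl (ι B) X W (ι u) (ι u′) (ι m) q)

  -- Rounding `(u + B) / (2 B)` down gives the largest `m` allowed by `tail-median`; its maximality
  -- is the upper bound on `u` that `contract` needs.
  divide : ∀ u b → ∃[ m ] (2 ℕ.* m ℕ.* suc b ℕ.≤ u ℕ.+ suc b × u ℕ.≤ 2 ℕ.* m ℕ.* suc b ℕ.+ suc b)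
  divide u b = m
    , ℕ.≤-trans (ℕ.≤-reflexive (swap m B)) (ℕ.m/n*n≤m (u ℕ.+ B) (2 ℕ.* B))
    , ℕ.+-cancelʳ-≤ B u (2 ℕ.* m ℕ.* B ℕ.+ B) (begin
        u ℕ.+ B                                        ≡⟨ ℕ.m≡m%n+[m/n]*n (u ℕ.+ B) (2 ℕ.* B) ⟩
        (u ℕ.+ B) ℕ.% (2 ℕ.* B) ℕ.+ m ℕ.* (2 ℕ.* B)    ≤⟨ ℕ.+-monoˡ-≤ (m ℕ.* (2 ℕ.* B)) (ℕ.<⇒≤ (ℕ.m%n<n (u ℕ.+ B) (2 ℕ.* B))) ⟩
        2 ℕ.* B ℕ.+ m ℕ.* (2 ℕ.* B)                    ≡⟨ double m B ⟩
        2 ℕ.* m ℕ.* B ℕ.+ B ℕ.+ B                      ∎)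
    where
      open ℕ.≤-Reasoning
      B = suc b
      m = (u ℕ.+ B) ℕ./ (2 ℕ.* B)
      swap : ∀ m B → 2 ℕ.* m ℕ.* B ≡ m ℕ.* (2 ℕ.* B)
      swap = solve-∀
      double : ∀ m B → 2 ℕ.* B ℕ.+ m ℕ.* (2 ℕ.* B) ≡ 2 ℕ.* m ℕ.* B ℕ.+ B ℕ.+ B
      double = solve-∀

  ½*<1 : ∀ {q} → q < 1ℚ → ½ * q < 1ℚ
  ½*<1 q<1 = ℚ.<-trans (ℚ.*-monoʳ-<-pos ½ q<1) (from-yes (½ ℚ.<? 1ℚ))

  0<1-½* : ∀ {q} → q < 1ℚ → 0ℚ < 1ℚ - ½ * q
  0<1-½* q<1 = <⇒0<- (½*<1 q<1)

  -- U is the set of vertices still uncovered after i steps, and c bounds the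
  -- number of colours spent on the others.
  greedy : ∀ {n k b q} (G : Graph n) → 0ℚ ≤ q → 0ℚ ≤ 1ℚ - ½ * q → q * ι (suc b) ≤ 1ℚ →
    (∀ U m → 2 ℕ.* m ℕ.* suc b ℕ.≤ ∣ U ∣ ℕ.+ suc b →
       ∃[ S ] (k ℕ.* suc (χ (G ⟦ S ⟧)) ℕ.< χ G × m ℕ.≤ ∣ S ∩ U ∣)) →
    ∀ i → ∃[ U ] ∃[ c ] (k ℕ.* (c ℕ.+ i) ℕ.+ i ℕ.≤ i ℕ.* χ G ×
      ι ∣ U ∣ ≤ ι (suc b) + (ι n - 1ℚ) * (1ℚ - ½ * q) ^ i ×
      (∀ c′ → ColourableOn G U c′ → ColourableOn G ⊤ (c ℕ.+ c′)))
  greedy {n} {k} {b} {q} G 0≤q 0≤w qB≤1 hit zero = ⊤ , 0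
    , ℕ.≤-reflexive (trans (ℕ.+-identityʳ (k ℕ.* 0)) (ℕ.*-zeroʳ k))
    -- Initially `∣ U ∣ = n`, which is `suc b + (n - 1)` less the slack `b`.
    , +⇒≤ (ι b) (0≤ι b) (begin
        ι ∣ ⊤ {n} ∣ + ι b               ≡⟨ cong (λ c → ι c + ι b) (∣⊤∣≡n n) ⟩
        ι n + ι b                       ≡⟨ solve 2 (λ n b → n :+ b := con 1ℚ :+ b :+ (n :- con 1ℚ) :* con 1ℚ) refl (ι n) (ι b) ⟩
        1ℚ + ι b + (ι n - 1ℚ) * 1ℚ      ≡⟨ cong (_+ (ι n - 1ℚ) * 1ℚ) (ι-suc b) ⟨
        ι (suc b) + (ι n - 1ℚ) * 1ℚ     ∎)
    , λ c′ col → col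
    where open ≡-Reasoning
  greedy {n} {k} {b} {q} G 0≤q 0≤w qB≤1 hit (suc i)
    with U , c , cost , size , extend ← greedy {k = k} G 0≤q 0≤w qB≤1 hit i
    with m , fits , maximal ← divide ∣ U ∣ b
    with S , low , m≤S∩U ← hit U m fits
    = U ─ S , c ℕ.+ χ (G ⟦ S ⟧)
    -- The strictness of `low` pays for the additional unit in the summand `i` of the cost bound.
    , ℕ.≤-trans (ℕ.≤-reflexive (regroup k c i (χ (G ⟦ S ⟧)))) (ℕ.+-mono-≤ low cost)
    , contract {q} {ι n - 1ℚ} {(1ℚ - ½ * q) ^ i} (suc b) ∣ U ∣ ∣ U ─ S ∣ m 0≤q 0≤w qB≤1
        (ℕ.≤-trans (ℕ.+-monoʳ-≤ ∣ U ─ S ∣ m≤S∩U) (ℕ.≤-reflexive (∣─∣+∣∩∣ U S)))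
        maximal size
    , λ c′ col → subst (ColourableOn G ⊤) (sym (ℕ.+-assoc c (χ (G ⟦ S ⟧)) c′))
        (extend (χ (G ⟦ S ⟧) ℕ.+ c′)
          (split G U S (induced⇒on G S (proj₁ (proj₂ (chromaticNumber (G ⟦ S ⟧))))) col))
    where
      regroup : ∀ k c i x → k ℕ.* (c ℕ.+ x ℕ.+ suc i) ℕ.+ suc i ≡
                suc (k ℕ.* suc x) ℕ.+ (k ℕ.* (c ℕ.+ i) ℕ.+ i)
      regroup = solve-∀

  -- The suc k sets found cost at most χ G - suc k - 1 colours, and fewer than
  -- b + 1 ≤ suc k + 1 vertices remain.
  overspent : ∀ {n k b x} (G : Graph n) → x < 1ℚ → b ℕ.≤ suc k →
    ¬ (∃[ U ] ∃[ c ] (suc k ℕ.* (c ℕ.+ suc k) ℕ.+ suc k ℕ.≤ suc k ℕ.* χ G ×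
      ι ∣ U ∣ ≤ ι b + x × (∀ c′ → ColourableOn G U c′ → ColourableOn G ⊤ (c ℕ.+ c′))))
  overspent {n} {k} {b} {x} G x<1 b≤k (U , c , cost , size , extend) =
    ℕ.<-irrefl refl (ℕ.<-≤-trans (ℕ.s≤s χ≤c+1+k)
      (ℕ.*-cancelˡ-≤ (suc k) (ℕ.≤-trans (ℕ.≤-reflexive (collect (suc k) c)) cost)))
    where
      collect : ∀ k c → k ℕ.* suc (c ℕ.+ k) ≡ k ℕ.* (c ℕ.+ k) ℕ.+ k
      collect = solve-∀
      ∣U∣≤b : ∣ U ∣ ℕ.≤ b
      ∣U∣≤b = ℕ.s≤s⁻¹ (ι-cancel-< {∣ U ∣} {suc b} (begin-strict
        ι ∣ U ∣     ≤⟨ size ⟩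
        ι b + x     <⟨ ℚ.+-monoʳ-< (ι b) x<1 ⟩
        ι b + 1ℚ    ≡⟨ ℚ.+-comm (ι b) 1ℚ ⟩
        1ℚ + ι b    ≡⟨ ι-suc b ⟨
        ι (suc b)   ∎))
        where open ℚ.≤-Reasoning
      χ≤c+1+k : χ G ℕ.≤ c ℕ.+ suc k
      χ≤c+1+k = ℕ.≤-trans (χ-least G (extend ∣ U ∣ (on-size G U)))
        (ℕ.+-monoʳ-≤ c (ℕ.≤-trans ∣U∣≤b b≤k))

  -- The logarithm enters through two consequences only: `1 ≤ q · suc k` bounds the block size by
  -- `suc k`, and the power bound brings the greedy remainder below one.
  low-improbable : ∀ {n k q} (G : Graph n) (E : Subset n → Bool) → 0ℚ < q → q < 1ℚ →
    1ℚ ≤ q * ι (suc k) → ι n * (1ℚ - ½ * q) ^ suc k ≤ 1ℚ →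
    (∀ S → E S ≡ true → suc k ℕ.* suc (χ (G ⟦ S ⟧)) ℕ.< χ G) → ¬ (½ < prob q E)
  low-improbable {n} {k} {q} G E 0<q q<1 1≤qk power low ½<prob =
    overspent {n} {k} {suc b} {(ι n - 1ℚ) * W} G remainder b≤k
      (greedy {n} {suc k} {b} {q} G (ℚ.<⇒≤ 0<q) (ℚ.<⇒≤ (0<1-½* q<1)) qB≤1 hit (suc k))
    where
      W = (1ℚ - ½ * q) ^ suc k
      b = proj₁ (block-size 0<q q<1)
      qB≤1 = proj₁ (proj₂ (block-size 0<q q<1))
      block = proj₂ (proj₂ (block-size 0<q q<1))
      b≤k : suc b ℕ.≤ suc k
      b≤k = ι-cancel-≤ {suc b} {suc k}
        (ℚ.*-cancelˡ-≤-pos q {{ℚ.positive 0<q}} (ℚ.≤-trans qB≤1 1≤qk))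
      hit : ∀ U j → 2 ℕ.* j ℕ.* suc b ℕ.≤ ∣ U ∣ ℕ.+ suc b →
            ∃[ S ] (suc k ℕ.* suc (χ (G ⟦ S ⟧)) ℕ.< χ G × j ℕ.≤ ∣ S ∩ U ∣)
      hit U j h =
        let S , S∈E , j≤ = meets (ℚ.<⇒≤ 0<q) (ℚ.<⇒≤ q<1) {suc b} block E ½<prob U j h in
        S , low S S∈E , ℕ.≤ᵇ⇒≤ j ∣ S ∩ U ∣ (subst T (sym j≤) _)
      -- Starting from `n - 1` instead of `n` makes the bound strict, because `W` is positive.
      remainder : (ι n - 1ℚ) * W < 1ℚ
      remainder = begin-strict
        (ι n - 1ℚ) * W   ≡⟨ solve 2 (λ n x → (n :- con 1ℚ) :* x := n :* x :- x) refl (ι n) W ⟩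
        ι n * W - W      <⟨ ℚ.+-monoʳ-< (ι n * W) (ℚ.neg-antimono-< (0<^ (suc k) (0<1-½* q<1))) ⟩
        ι n * W + 0ℚ     ≡⟨ ℚ.+-identityʳ (ι n * W) ⟩
        ι n * W          ≤⟨ power ⟩
        1ℚ               ∎
        where open ℚ.≤-Reasoning

  -- For the Riemann sum `Λ` and `q = 2 r Λ`, half of `q` is the quantity `r Λ` of `lnSum-power`,
  -- and `q · suc k = 2 Λ ≥ 1` because `Λ ≥ ½` when `n ≥ 2`.
  low-improbable-ln : ∀ {n k r} (G : Graph n) (E : Subset n → Bool) m → 2 ℕ.≤ n →
    0ℚ < r → ι (suc k) * r ≡ 1ℚ → r * (ι 2 * lnSum n m) < 1ℚ →
    (∀ S → E S ≡ true → suc k ℕ.* suc (χ (G ⟦ S ⟧)) ℕ.< χ G) → ¬ (½ < prob (r * (ι 2 * lnSum n m)) E)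
  low-improbable-ln {n} {k} {r} G E m 2≤n 0<r kr≡1 q<1 = low-improbable {n} {k} G E
    (*-pos 0<r (ℚ.<-≤-trans 0<1 1≤2Λ)) q<1
    (subst (1ℚ ≤_) (sym (trans (regroup (ι (suc k)) r (ι 2 * lnSum n m))
      (trans (cong (_* (ι 2 * lnSum n m)) kr≡1) (ℚ.*-identityˡ (ι 2 * lnSum n m))))) 1≤2Λ)
    (subst (λ x → ι n * (1ℚ - x) ^ suc k ≤ 1ℚ) (sym ½q≡rΛ)
      (lnSum-power {suc k} {r} m (ℕ.<⇒≤ 2≤n) (ℚ.<⇒≤ 0<r) kr≡1
        (subst (_≤ 1ℚ) ½q≡rΛ (ℚ.<⇒≤ (½*<1 q<1)))))
    where
      1≤2Λ : 1ℚ ≤ ι 2 * lnSum n m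
      1≤2Λ = ℚ.*-monoˡ-≤-nonNeg (ι 2) (lnSum-≥½ n m 2≤n)
      regroup : ∀ k r x → (r * x) * k ≡ k * r * x
      regroup = solve 3 (λ k r x → (r :* x) :* k := k :* r :* x) refl
      cancel : ∀ r Λ → ½ * (r * (ι 2 * Λ)) ≡ r * Λ
      cancel = solve 2 (λ r Λ → con ½ :* (r :* (con (ι 2) :* Λ)) := r :* Λ) refl
      ½q≡rΛ : ½ * (r * (ι 2 * lnSum n m)) ≡ r * lnSum n m
      ½q≡rΛ = cancel r (lnSum n m)

open Covering

open import Data.Integer.Base using (+_; -[1+_])
open import Defs
open Reciprocal
open CauchyClosure
open Decidability

-- Equal reals give equal probabilities, and probabilities are computed termwise

module RealCongruence where
  open +-*-Solver using (solve; _:+_; _:-_; :-_; _:=_)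

  ≃-refl : ∀ {x} → x ≃ x
  ≃-refl {x} ε 0<ε = 0 , λ m _ →
    subst (ℚ._< ε) (sym (cong ℚ.∣_∣ (ℚ.+-inverseʳ (seq x m)))) 0<ε

  ≃-sym : ∀ {x y} → x ≃ y → y ≃ x
  ≃-sym {x} {y} x≃y ε 0<ε = proj₁ (x≃y ε 0<ε) , λ m h →
    subst (ℚ._< ε) (abs-sym (seq x m) (seq y m)) (proj₂ (x≃y ε 0<ε) m h)

  ≃-trans : ∀ {x y z} → x ≃ y → y ≃ z → x ≃ z
  ≃-trans {x} {y} {z} x≃y y≃z ε 0<ε = proj₁ ev , λ m h → begin-strict
    ℚ.∣ seq x m ℚ.- seq z m ∣
      ≡⟨ cong ℚ.∣_∣ (solve 3 (λ x y z → x :- z := (x :- y) :+ (y :- z)) refl (seq x m) (seq y m) (seq z m)) ⟩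
    ℚ.∣ (seq x m ℚ.- seq y m) ℚ.+ (seq y m ℚ.- seq z m) ∣
      ≤⟨ ℚ.∣p+q∣≤∣p∣+∣q∣ (seq x m ℚ.- seq y m) (seq y m ℚ.- seq z m) ⟩
    ℚ.∣ seq x m ℚ.- seq y m ∣ ℚ.+ ℚ.∣ seq y m ℚ.- seq z m ∣
      <⟨ ℚ.+-mono-< (proj₁ (proj₂ ev m h)) (proj₂ (proj₂ ev m h)) ⟩
    ½ ℚ.* ε ℚ.+ ½ ℚ.* ε
      ≡⟨ halves ε ⟩
    ε ∎
    where
      open ℚ.≤-Reasoning
      ev = both (x≃y (½ ℚ.* ε) (half-pos 0<ε)) (y≃z (½ ℚ.* ε) (half-pos 0<ε))

  +-cong : ∀ {x x′ y y′} → x ≃ x′ → y ≃ y′ → x + y ≃ x′ + y′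
  +-cong {x} {x′} {y} {y′} x≃x′ y≃y′ ε 0<ε = proj₁ ev , λ m h → begin-strict
    ℚ.∣ seq x m ℚ.+ seq y m ℚ.- (seq x′ m ℚ.+ seq y′ m) ∣
      ≡⟨ cong ℚ.∣_∣ (solve 4 (λ x x′ y y′ → x :+ y :- (x′ :+ y′) := (x :- x′) :+ (y :- y′)) refl
           (seq x m) (seq x′ m) (seq y m) (seq y′ m)) ⟩
    ℚ.∣ (seq x m ℚ.- seq x′ m) ℚ.+ (seq y m ℚ.- seq y′ m) ∣
      ≤⟨ ℚ.∣p+q∣≤∣p∣+∣q∣ (seq x m ℚ.- seq x′ m) (seq y m ℚ.- seq y′ m) ⟩
    ℚ.∣ seq x m ℚ.- seq x′ m ∣ ℚ.+ ℚ.∣ seq y m ℚ.- seq y′ m ∣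
      <⟨ ℚ.+-mono-< (proj₁ (proj₂ ev m h)) (proj₂ (proj₂ ev m h)) ⟩
    ½ ℚ.* ε ℚ.+ ½ ℚ.* ε
      ≡⟨ halves ε ⟩
    ε ∎
    where
      open ℚ.≤-Reasoning
      ev = both (x≃x′ (½ ℚ.* ε) (half-pos 0<ε)) (y≃y′ (½ ℚ.* ε) (half-pos 0<ε))

  neg-cong : ∀ {x y} → x ≃ y → - x ≃ - y
  neg-cong {x} {y} x≃y ε 0<ε = proj₁ (x≃y ε 0<ε) , λ m h → subst (ℚ._< ε)
    (trans (abs-sym (seq x m) (seq y m))
      (cong ℚ.∣_∣ (solve 2 (λ x y → y :- x := (:- x) :- (:- y)) refl (seq x m) (seq y m))))
    (proj₂ (x≃y ε 0<ε) m h)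

  *-cong : ∀ {x x′ y y′} → x ≃ x′ → y ≃ y′ → x * y ≃ x′ * y′
  *-cong {x} {x′} {y} {y′} x≃x′ y≃y′ ε 0<ε = proj₁ ev , λ m h →
    subst (ℚ.∣ seq x m ℚ.* seq y m ℚ.- seq x′ m ℚ.* seq y′ m ∣ ℚ.<_) δC≡ε
      (product-close (seq x m) (seq y m) (seq x′ m) (seq y′ m) {C} {δ} 0<C
        (ℚ.≤-trans (proj₁ (proj₁ (proj₂ ev m h))) (+⇒≤ B (ℚ.<⇒≤ 0<B) refl))
        (ℚ.≤-trans (proj₂ (proj₁ (proj₂ ev m h))) (+⇒≤ A (ℚ.<⇒≤ 0<A) (ℚ.+-comm B A)))
        (proj₁ (proj₂ (proj₂ ev m h))) (proj₂ (proj₂ (proj₂ ev m h))))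
    where
      ∣y∣≤A = bounded {seq y} (cauchy y)
      A = proj₁ ∣y∣≤A
      0<A = proj₁ (proj₂ ∣y∣≤A)
      ∣x′∣≤B = bounded {seq x′} (cauchy x′)
      B = proj₁ ∣x′∣≤B
      0<B = proj₁ (proj₂ ∣x′∣≤B)
      C = A ℚ.+ B
      0<C : 0ℚ ℚ.< C
      0<C = ℚ.+-mono-< 0<A 0<B
      -- With `C` bounding both cofactors, factors closer than `δ` give products closer than
      -- `2 δ C = ε`.
      δ = (½ ℚ.* ε) ℚ.* recip C
      0<δ : 0ℚ ℚ.< δ
      0<δ = *-pos (half-pos 0<ε) (recip-pos 0<C)
      δC≡ε : δ ℚ.* C ℚ.+ δ ℚ.* C ≡ ε
      δC≡ε = trans (cong (λ z → z ℚ.+ z) (cancelʳ (½ ℚ.* ε) 0<C)) (halves ε)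
      ev = both (both (proj₂ (proj₂ ∣y∣≤A)) (proj₂ (proj₂ ∣x′∣≤B)))
        (both (x≃x′ δ 0<δ) (y≃y′ δ 0<δ))

  mass-cong : ∀ {n p p′} → p ≃ p′ → (S : Subset n) → mass p S ≃ mass p′ S
  mass-cong p≃p′ []            = ≃-refl {1ℝ}
  mass-cong {p = p} {p′} p≃p′ (outside ∷ S) =
    *-cong {1ℝ - p} {1ℝ - p′} {mass p S} {mass p′ S}
      (+-cong {1ℝ} {1ℝ} { - p} { - p′} (≃-refl {1ℝ}) (neg-cong {p} {p′} p≃p′))
      (mass-cong {p = p} {p′} p≃p′ S)
  mass-cong {p = p} {p′} p≃p′ (inside ∷ S) =
    *-cong {p} {p′} {mass p S} {mass p′ S} p≃p′ (mass-cong {p = p} {p′} p≃p′ S)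

  sumSubsets-cong : ∀ {n} {f g : Subset n → ℝ} → (∀ S → f S ≃ g S) → sumSubsets f ≃ sumSubsets g
  sumSubsets-cong {zero}          f≃g = f≃g []
  sumSubsets-cong {suc n} {f} {g} f≃g = +-cong
    {sumSubsets (f ∘ (outside ∷_))} {sumSubsets (g ∘ (outside ∷_))}
    {sumSubsets (f ∘ (inside ∷_))} {sumSubsets (g ∘ (inside ∷_))}
    (sumSubsets-cong (f≃g ∘ (outside ∷_))) (sumSubsets-cong (f≃g ∘ (inside ∷_)))

  Pr-cong : ∀ {n p p′} {E : Pred (Subset n) 0ℓ} (E? : Decidable E) → p ≃ p′ → Pr p E E? ≃ Pr p′ E E?
  Pr-cong {p = p} {p′} E? p≃p′ = sumSubsets-cong λ S → choose (does (E? S)) S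
    where
      choose : ∀ b S → (if b then mass p S else 0ℝ) ≃ (if b then mass p′ S else 0ℝ)
      choose true  S = mass-cong {p = p} {p′} p≃p′ S
      choose false S = ≃-refl {0ℝ}

  seq-mass : ∀ {n} p (S : Subset n) m → seq (mass p S) m ≡ massℚ (seq p m) S
  seq-mass p []            m = refl
  seq-mass p (outside ∷ S) m = cong ((1ℚ ℚ.- seq p m) ℚ.*_) (seq-mass p S m)
  seq-mass p (inside  ∷ S) m = cong (seq p m ℚ.*_) (seq-mass p S m)

  seq-sumSubsets : ∀ {n} (f : Subset n → ℝ) m → seq (sumSubsets f) m ≡ sumℚ (λ S → seq (f S) m)
  seq-sumSubsets {zero}  f m = refl
  seq-sumSubsets {suc n} f m =
    cong₂ ℚ._+_ (seq-sumSubsets (f ∘ (outside ∷_)) m) (seq-sumSubsets (f ∘ (inside ∷_)) m)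

  -- An exact equality, since real operations act termwise; thus a single rational approximation can
  -- carry the whole argument.
  seq-Pr : ∀ {n} p {E : Pred (Subset n) 0ℓ} (E? : Decidable E) m →
           seq (Pr p E E?) m ≡ prob (seq p m) (does ∘ E?)
  seq-Pr p E? m = trans (seq-sumSubsets (λ S → if does (E? S) then mass p S else 0ℝ) m)
    (sumℚ-cong λ S → choose (does (E? S)) S)
    where
      choose : ∀ b S → seq (if b then mass p S else 0ℝ) m ≡ (if b then massℚ (seq p m) S else 0ℚ)
      choose true  S = seq-mass p S m
      choose false S = refl

open RealCongruence

-- Transfer from rational approximations to the real probability

-- A late term of the ratio is at least one, as `x ≥ 1` and `0 < y < 1` there, and lies within ½ of
-- `k`; hence `k > ½`.
integer-ratio-pos : ∀ {x y} (0<y : 0ℝ < y) k → (x≥½ : ∀ m → 1ℚ ℚ.≤ seq x m) → y < 1ℝ →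
                    x / y [ 0<y ] ≃ fromℤ k → ∃[ k′ ] k ≡ + suc k′
integer-ratio-pos {x} {y} 0<y k 1≤x (ε , 0<ε , y+ε≤1) x/y≃k
  with m , (near , y+ε≤1ₘ) , y≥ ← witness (both (both (x/y≃k ½ 0<½) y+ε≤1) (eventually-≥ {y} 0<y))
  = positive-numerator k (ℚ.<-trans 0<½ (near-half {c = 1ℚ} 1≤ratio near))
  where
    0<yₘ = ℚ.<-≤-trans (proj₁ (proj₂ 0<y)) y≥
    1≤recip : 1ℚ ℚ.≤ recip (seq y m)
    1≤recip = recip-antitone 0<yₘ (ℚ.≤-trans (+⇒≤ ε (ℚ.<⇒≤ 0<ε) refl) y+ε≤1ₘ)
    1≤ratio : 1ℚ ℚ.≤ seq x m ℚ.* recip (seq y m)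
    1≤ratio = *-mono 0≤1 (ℚ.<⇒≤ (recip-pos 0<yₘ)) (1≤x m) 1≤recip
    positive-numerator : ∀ k → 0ℚ ℚ.< k ℚ./ 1 → ∃[ k′ ] k ≡ + suc k′
    positive-numerator (+ suc k′) _   = k′ , refl
    positive-numerator (+ zero)   0<0 = contradiction 0<0 (ℚ.<-irrefl refl)
    positive-numerator -[1+ k ]   0<k =
      contradiction (ℚ.<-trans 0<k (ℚ.neg-antimono-< (0<ι k))) (ℚ.<-irrefl refl)

-- The gap `ε` in the real inequality absorbs the distance between `x` and `y`, leaving strict
-- inequalities of rational terms.
eventually-> : ∀ {c x y} → x ≃ y → fromℚ c < x → Eventually λ m → c ℚ.< seq y m
eventually-> {c} {x} {y} x≃y (ε , 0<ε , c+ε≤x) = proj₁ ev , λ m h → ℚ.≰⇒> λ y≤c →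
  ℚ.<-irrefl refl (ℚ.≤-<-trans (proj₁ (proj₂ ev m h))
    (ℚ.<-≤-trans (near-< (seq x m) (seq y m) (proj₂ (proj₂ ev m h))) (ℚ.+-monoˡ-≤ ε y≤c)))
  where ev = both c+ε≤x (x≃y ε 0<ε)

eventually-< : ∀ {c x y} → x ≃ y → x < fromℚ c → Eventually λ m → seq y m ℚ.< c
eventually-< {c} {x} {y} x≃y (ε , 0<ε , x+ε≤c) = proj₁ ev , λ m h →
  ℚ.<-≤-trans
    (near-< (seq y m) (seq x m) (subst (ℚ._< ε) (abs-sym (seq x m) (seq y m)) (proj₂ (proj₂ ev m h))))
    (proj₁ (proj₂ ev m h))
  where ev = both x+ε≤c (x≃y ε 0<ε)

<-rational : ∀ {c y q} → y ≃ fromℚ q → fromℚ c < y → c ℚ.< q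
<-rational {c} {y} {q} y≃q c<y = proj₂ (witness (eventually-> {c} {y} {fromℚ q} y≃q c<y))

quotient-cancel : ∀ {x y} (0<y : 0ℝ < y) → x / y [ 0<y ] * y ≃ x
quotient-cancel {x} {y} 0<y ε 0<ε = proj₁ (eventually-≥ {y} 0<y) , λ m h →
  subst (λ z → ℚ.∣ z ℚ.- seq x m ∣ ℚ.< ε)
    (sym (cancelʳ (seq x m) (ℚ.<-≤-trans (proj₁ (proj₂ 0<y)) (proj₂ (eventually-≥ {y} 0<y) m h))))
    (proj₂ (≃-refl {x} ε 0<ε) m z≤n)

-- The threshold equals the rational `κ χ(G) - 1`; multiplying by `k` turns the event into an
-- inequality of natural numbers.
lowChromatic-scaled : ∀ {n k κ p} (2≤n : 2 ℕ.≤ n) (G : Graph n) S →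
  ι k ℚ.* κ ≡ 1ℚ → 0ℚ ℚ.< ι k → p / (fromℕ 2 * ln n) [ 0<2ln 2≤n ] ≃ fromℚ κ →
  LowChromatic p 2≤n G S → k ℕ.* suc (χ (G ⟦ S ⟧)) ℕ.< χ G
lowChromatic-scaled {n} {k} {κ} {p} 2≤n G S kκ≡1 0<k p/2ln≃κ low = ι-cancel-< (begin-strict
  ι (k ℕ.* suc c)
    ≡⟨ trans (ι-* k (suc c)) (cong (ι k ℚ.*_) (ι-suc c)) ⟩
  ι k ℚ.* (1ℚ ℚ.+ ι c)
    <⟨ ℚ.*-monoʳ-<-pos (ι k) {{ℚ.positive 0<k}} (ℚ.+-monoʳ-< 1ℚ
         (<-rational {ι c} {threshold p 2≤n G} {κ ℚ.* ι (χ G) ℚ.- 1ℚ}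
           (affine-rational {p / (fromℕ 2 * ln n) [ 0<2ln 2≤n ]} (χ G) p/2ln≃κ) low)) ⟩
  ι k ℚ.* (1ℚ ℚ.+ (κ ℚ.* ι (χ G) ℚ.- 1ℚ))
    ≡⟨ solve 3 (λ k κ x → k :* (con 1ℚ :+ (κ :* x :- con 1ℚ)) := k :* κ :* x) refl (ι k) κ (ι (χ G)) ⟩
  ι k ℚ.* κ ℚ.* ι (χ G)
    ≡⟨ cong (ℚ._* ι (χ G)) kκ≡1 ⟩
  1ℚ ℚ.* ι (χ G)
    ≡⟨ ℚ.*-identityˡ (ι (χ G)) ⟩
  ι (χ G) ∎)
  where
    open ℚ.≤-Reasoning
    open +-*-Solver using (solve; con; _:+_; _:*_; _:-_; _:=_)
    c = χ (G ⟦ S ⟧)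

-- If 2 ln n / p = k, then p can be replaced by (2 ln n) / k, whose approximations
-- are rational multiples of the Riemann sums.
Pr-lowChromatic-+ : ∀ {n k} (2≤n : 2 ℕ.≤ n) (G : Graph n) (p : ℝ) (0<p : 0ℝ < p) → p < 1ℝ →
  (fromℕ 2 * ln n) / p [ 0<p ] ≃ fromℤ (+ suc k) →
  (E? : Decidable (LowChromatic p 2≤n G)) → Pr p (LowChromatic p 2≤n G) E? ≤ fromℚ ½
Pr-lowChromatic-+ {n} {k} 2≤n G p 0<p p<1 2ln/p≃k E? ½<P = refute (proj₁ w) (proj₂ w)
  where
    r = recip (ι (suc k))
    0<r : 0ℚ ℚ.< r
    0<r = recip-pos (0<ι k)
    kr≡1 : ι (suc k) ℚ.* r ≡ 1ℚ
    kr≡1 = recip-inverse (>⇒≢ (0<ι k))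
    2ln = fromℕ 2 * ln n
    p/2ln≃r : p / 2ln [ 0<2ln 2≤n ] ≃ fromℚ r
    p/2ln≃r = proj₂ (quotient-rational {2ln} {p} (0<2ln 2≤n) 0<p (+ suc k , 2ln/p≃k))
    -- Its term at `m` is by definition `r * (ι 2 * lnSum n m)`, the probability in
    -- `low-improbable-ln`.
    p′ = fromℚ r * 2ln
    p≃p′ : p ≃ p′
    p≃p′ = ≃-trans {p} {p / 2ln [ 0<2ln 2≤n ] * 2ln} {p′}
      (≃-sym {p / 2ln [ 0<2ln 2≤n ] * 2ln} {p} (quotient-cancel {p} {2ln} (0<2ln 2≤n)))
      (*-cong {p / 2ln [ 0<2ln 2≤n ]} {fromℚ r} {2ln} {2ln} p/2ln≃r (≃-refl {2ln}))
    P = Pr p (LowChromatic p 2≤n G) E?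
    -- Only the sampling weights change; the event and its decision `E?` still refer to `p`.
    P′ = Pr p′ (LowChromatic p 2≤n G) E?
    -- One index at which both strict bounds hold already yields the contradiction.
    w : ∃[ m ] (½ ℚ.< seq P′ m × seq p′ m ℚ.< 1ℚ)
    w = witness (both
      (eventually-> {½} {P} {P′} (Pr-cong {p = p} {p′} E? p≃p′) ½<P)
      (eventually-< {1ℚ} {p} {p′} p≃p′ p<1))
    from-does : ∀ {A : Set} (d : Dec A) → does d ≡ true → A
    from-does (yes a) _ = a
    refute : ∀ m → ¬ (½ ℚ.< seq P′ m × seq p′ m ℚ.< 1ℚ)
    refute m (½<P′ , p′<1) = low-improbable-ln {n} {k} {r} G (does ∘ E?) m 2≤n 0<r kr≡1 p′<1
      (λ S S∈E → lowChromatic-scaled {n} {suc k} {r} {p} 2≤n G S kr≡1 (0<ι k) p/2ln≃r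
        (from-does (E? S) S∈E))
      (subst (½ ℚ.<_) (seq-Pr p′ E? m) ½<P′)

-- Keeps `k` a variable, so that its equation with a positive integer can be matched.
Pr-lowChromatic : ∀ {n k} (2≤n : 2 ℕ.≤ n) (G : Graph n) (p : ℝ) (0<p : 0ℝ < p) → p < 1ℝ →
  (fromℕ 2 * ln n) / p [ 0<p ] ≃ fromℤ k → ∃[ k′ ] k ≡ + suc k′ →
  (E? : Decidable (LowChromatic p 2≤n G)) → Pr p (LowChromatic p 2≤n G) E? ≤ fromℚ ½
Pr-lowChromatic 2≤n G p 0<p p<1 2ln/p≃k (k′ , refl) =
  Pr-lowChromatic-+ {k = k′} 2≤n G p 0<p p<1 2ln/p≃k

lemma8p2 : (n : ℕ) (2≤n : 2 ℕ.≤ n) (G : Graph n)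
    (p : ℝ) (0<p : 0ℝ < p) → p < 1ℝ →
    (int : IsInteger ((fromℕ 2 * ln n) / p [ 0<p ])) →
    Pr p
    (λ S → fromℕ (χ (G ⟦ S ⟧)) < p / (fromℕ 2 * ln n) [ 0<2ln 2≤n ] * fromℕ (χ G) - 1ℝ)
    (lowChromatic? p 2≤n 0<p int G)
    ≤ fromℚ ½
lemma8p2 n 2≤n G p 0<p p<1 int@(k , 2ln/p≃k) =
  Pr-lowChromatic {n} {k} 2≤n G p 0<p p<1 2ln/p≃k
    (integer-ratio-pos {fromℕ 2 * ln n} {p} 0<p k
      (λ m → ℚ.*-monoˡ-≤-nonNeg (ι 2) (lnSum-≥½ n m 2≤n)) p<1 2ln/p≃k)
    (lowChromatic? p 2≤n 0<p int G)
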